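{- Let $(G,d)$ be a group with a two-sided invariant metric and $A\le G$ a closed subgroup. Let $\langle t\rangle\cong\mathbb Z$ with metric $d(t^m,t^n)=|m-n|$, and let $d$ also denote the Graev metric on the free product $G*\langle t\rangle$. The subgroup of $G*\langle t\rangle$ generated by $G$ and $tAt^{ -1}$ is (as an abstract group) the free product $G*tAt^{ -1}$; equip $tAt^{ -1}$ with the metric $d(ta_1t^{ -1},ta_2t^{ -1})=d(a_1,a_2)$ and let $\underline d$ be the Graev metric on the free product $(G,d)*(tAt^{ -1},d)$. Then $d|_{G*tAt^{ -1}}=\underline d$ if and only if $\operatorname{diam}_d(A)\le 1$.
   Context: Graev metric on a free product (amalgamation over the trivial group): for groups $(H_1,d_1),(H_2,d_2)$ with two-sided invariant metrics, let $H=H_1\cup H_2$ (with $H_1\cap H_2=\{e\}$) carry the metric equal to $d_i$ on $H_i$ and $d(h_1,h_2)=d_1(h_1,e)+d_2(e,h_2)$ for $h_1\in H_1$, $h_2\in H_2$. For words $\alpha$ over the alphabet $H$, $\hat\alpha$ is the product of its letters in $H_1*H_2$. The Graev metric is $\underline d(f_1,f_2)=\inf\{\sum_i d(\alpha_1(i),\alpha_2(i)):|\alpha_1|=|\alpha_2|,\ \hat\alpha_1=f_1,\ \hat\alpha_2=f_2\}$, a two-sided invariant metric on $H_1*H_2$ extending $d_1,d_2$. $\operatorname{diam}_d(A)=\sup\{d(a_1,a_2):a_1,a_2\in A\}$. -}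

module Defs where

open import Algebra.Bundles using (CommutativeRing; Group)
open import Algebra.Morphism.Structures using (module GroupMorphisms)
import Algebra.Morphism.Construct.Identity as Identity
import Algebra.Properties.AbelianGroup as AbelianGroupProperties
import Algebra.Properties.Monoid.Mult as Mult
import Algebra.Properties.Ring as RingProperties
open import Data.Integer.Base as ℤ using (ℤ; ∣_∣)
import Data.Integer.Properties as ℤ
import Data.Integer.Tactic.RingSolver as ℤ-Solver
open import Data.List.Base using (List; []; _∷_; _++_)
import Data.List.Properties as List
open import Data.Nat.Base as ℕ using (ℕ; zero; suc)
import Data.Nat.Properties as ℕ
open import Data.Product.Base using (Σ; ∃; ∃₂; ∃-syntax; _×_; _,_; proj₁; proj₂)
open import Data.Sum.Base using (_⊎_; inj₁; inj₂)
open import Data.Vec.Base as Vec using (Vec; []; _∷_)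
open import Function.Base using (_∘_; id)
open import Level using (Level) renaming (suc to lsuc)
open import Relation.Binary.Core using (Rel)
open import Relation.Binary.PropositionalEquality as ≡ using (_≡_)
import Relation.Binary.Construct.NonStrictToStrict as ToStrict
import Relation.Binary.Reasoning.Setoid as SetoidReasoning
open import Relation.Binary.Structures using (IsTotalOrder)
open import Relation.Nullary.Negation using (¬_; contradiction)
open import Relation.Unary using (Pred; _∈_; _∪_; Satisfiable)

module Bounds {u} {X : Set u} (_≤_ : Rel X u) where

  IsUpperBound IsLowerBound IsSupremum IsInfimum : Pred X u → Pred X u
  IsUpperBound S b = ∀ {s} → s ∈ S → s ≤ b
  IsLowerBound S b = ∀ {s} → s ∈ S → b ≤ s
  IsSupremum S m = IsUpperBound S m × (∀ {b} → IsUpperBound S b → m ≤ b)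
  IsInfimum S m = IsLowerBound S m × (∀ {b} → IsLowerBound S b → b ≤ m)


-- The real numbers are given by their usual axioms, which determine them up to
-- isomorphism (with excluded middle).
record CompleteOrderedField (u : Level) : Set (lsuc u) where
  infix 4 _≤_
  field
    commutativeRing : CommutativeRing u u

  open CommutativeRing commutativeRing public

  field
    _≤_          : Rel Carrier u
    isTotalOrder : IsTotalOrder _≈_ _≤_
    +-monoˡ-≤    : ∀ z {x y} → x ≤ y → x + z ≤ y + z
    *-nonNeg     : ∀ {x y} → 0# ≤ x → 0# ≤ y → 0# ≤ x * y
    0≉1          : ¬ (0# ≈ 1#)
    inverse      : ∀ x → ¬ (x ≈ 0#) → ∃[ y ] x * y ≈ 1#

  open Bounds _≤_ public

  field
    complete : ∀ (S : Pred Carrier u) → Satisfiable S →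
               ∃ (IsUpperBound S) → ∃ (IsSupremum S)

  open ToStrict _≈_ _≤_ public using (_<_)

  module ≤ = IsTotalOrder isTotalOrder

  private
    module AG = AbelianGroupProperties +-abelianGroup
    module R  = RingProperties ring

  open Mult +-monoid public using () renaming (_×_ to _×ᴿ_)

  fromℕ : ℕ → Carrier
  fromℕ n = n ×ᴿ 1#

  +-monoʳ-≤ : ∀ z {x y} → x ≤ y → z + x ≤ z + y
  +-monoʳ-≤ z {x} {y} p =
    ≤.≲-respˡ-≈ (+-comm x z) (≤.≲-respʳ-≈ (+-comm y z) (+-monoˡ-≤ z p))

  +-nonNeg : ∀ {x y} → 0# ≤ x → 0# ≤ y → 0# ≤ x + y
  +-nonNeg {x} {y} p q =
    ≤.trans p (≤.≲-respˡ-≈ (+-identityʳ x) (+-monoʳ-≤ x q))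

  neg-antimono-≤ : ∀ {x y} → x ≤ y → - y ≤ - x
  neg-antimono-≤ {x} {y} p =
    ≤.≲-respˡ-≈ lhs (≤.≲-respʳ-≈ rhs (+-monoˡ-≤ (- x + - y) p))
    where
    open SetoidReasoning setoid
    lhs : x + (- x + - y) ≈ - y
    lhs = begin
      x + (- x + - y)   ≈⟨ +-assoc x (- x) (- y) ⟨
      (x + - x) + - y   ≈⟨ +-congʳ (-‿inverseʳ x) ⟩
      0# + - y          ≈⟨ +-identityˡ (- y) ⟩
      - y               ∎
    rhs : y + (- x + - y) ≈ - x
    rhs = begin
      y + (- x + - y)   ≈⟨ +-congˡ (+-comm (- x) (- y)) ⟩
      y + (- y + - x)   ≈⟨ +-assoc y (- y) (- x) ⟨
      (y + - y) + - x   ≈⟨ +-congʳ (-‿inverseʳ y) ⟩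
      0# + - x          ≈⟨ +-identityˡ (- x) ⟩
      - x               ∎

  neg-involutive : ∀ x → - (- x) ≈ x
  neg-involutive = AG.⁻¹-involutive

  0≤1 : 0# ≤ 1#
  0≤1 with ≤.total 0# 1#
  ... | inj₁ p = p
  ... | inj₂ p = ≤.≲-respʳ-≈ eq (*-nonNeg 0≤-1 0≤-1)
    where
    0≤-1 : 0# ≤ - 1#
    0≤-1 = ≤.≲-respˡ-≈ AG.ε⁻¹≈ε (neg-antimono-≤ p)
    eq : - 1# * - 1# ≈ 1#
    eq = trans (R.-1*x≈-x (- 1#)) (neg-involutive 1#)

  fromℕ-nonNeg : ∀ n → 0# ≤ fromℕ n
  fromℕ-nonNeg zero    = ≤.refl
  fromℕ-nonNeg (suc n) = +-nonNeg 0≤1 (fromℕ-nonNeg n)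

  fromℕ-mono-≤ : ∀ {m n} → m ℕ.≤ n → fromℕ m ≤ fromℕ n
  fromℕ-mono-≤ {n = n} ℕ.z≤n = fromℕ-nonNeg n
  fromℕ-mono-≤ (ℕ.s≤s p) = +-monoʳ-≤ 1# (fromℕ-mono-≤ p)

  fromℕ-homo-+ : ∀ m n → fromℕ (m ℕ.+ n) ≈ fromℕ m + fromℕ n
  fromℕ-homo-+ m n = Mult.×-homo-+ +-monoid 1# m n

  fromℕ≈0 : ∀ n → fromℕ n ≈ 0# → n ≡ 0
  fromℕ≈0 zero    _ = ≡.refl
  fromℕ≈0 (suc n) p = contradiction (≤.antisym 0≤1 1≤0) 0≉1
    where
    1≤0 : 1# ≤ 0#
    1≤0 = ≤.≲-respˡ-≈ (+-identityʳ 1#)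
            (≤.≲-respʳ-≈ p (+-monoʳ-≤ 1# (fromℕ-nonNeg n)))

  infimum : ∀ (S : Pred Carrier u) → Satisfiable S →
            ∃ (IsLowerBound S) → ∃ (IsInfimum S)
  infimum S (s , s∈S) (b , b≤) = - m , lower , greatest
    where
    -S : Pred Carrier u
    -S x = ∃[ y ] y ∈ S × x ≈ - y
    sup : ∃ (IsSupremum -S)
    sup = complete -S (- s , s , s∈S , refl)
      (- b , λ (_ , y∈S , eq) →
        ≤.≲-respˡ-≈ (sym eq) (neg-antimono-≤ (b≤ y∈S)))
    m : Carrier
    m = proj₁ sup
    lower : IsLowerBound S (- m)
    lower {y} y∈S = ≤.≲-respʳ-≈ (neg-involutive y)
      (neg-antimono-≤ (proj₁ (proj₂ sup) (y , y∈S , refl)))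
    greatest : ∀ {c} → IsLowerBound S c → c ≤ - m
    greatest {c} c≤ = ≤.≲-respˡ-≈ (neg-involutive c)
      (neg-antimono-≤ (proj₂ (proj₂ sup) λ (_ , y∈S , eq) →
        ≤.≲-respˡ-≈ (sym eq) (neg-antimono-≤ (c≤ y∈S))))


record Subgroup {u} (G : Group u u) : Set (lsuc u) where
  open Group G
  field
    Member    : Pred Carrier u
    resp      : ∀ {x y} → x ≈ y → Member x → Member y
    ε-closed  : Member ε
    ∙-closed  : ∀ {x y} → Member x → Member y → Member (x ∙ y)
    ⁻¹-closed : ∀ {x} → Member x → Member (x ⁻¹)

  group : Group u u
  group = record
    { Carrier = Σ Carrier Member
    ; _≈_     = λ x y → proj₁ x ≈ proj₁ y
    ; _∙_     = λ (x , p) (y , q) → x ∙ y , ∙-closed p q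
    ; ε       = ε , ε-closed
    ; _⁻¹     = λ (x , p) → x ⁻¹ , ⁻¹-closed p
    ; isGroup = record
      { isMonoid = record
        { isSemigroup = record
          { isMagma = record
            { isEquivalence = record { refl = refl ; sym = sym ; trans = trans }
            ; ∙-cong        = ∙-cong
            }
          ; assoc = λ x y z → assoc (proj₁ x) (proj₁ y) (proj₁ z)
          }
        ; identity = (λ x → identityˡ (proj₁ x)) , (λ x → identityʳ (proj₁ x))
        }
      ; inverse = (λ x → inverseˡ (proj₁ x)) , (λ x → inverseʳ (proj₁ x))
      ; ⁻¹-cong = ⁻¹-cong
      }
    }

module _ {u} (G : Group u u) where
  open Group G

  data Generated (S : Pred Carrier u) : Pred Carrier u where
    gen∈  : ∀ {x} → x ∈ S → Generated S x
    gen≈  : ∀ {x y} → x ≈ y → Generated S x → Generated S y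
    genε  : Generated S ε
    gen∙  : ∀ {x y} → Generated S x → Generated S y → Generated S (x ∙ y)
    gen⁻¹ : ∀ {x} → Generated S x → Generated S (x ⁻¹)

  subgroupGeneratedBy : Pred Carrier u → Subgroup G
  subgroupGeneratedBy S = record
    { Member    = Generated S
    ; resp      = gen≈
    ; ε-closed  = genε
    ; ∙-closed  = gen∙
    ; ⁻¹-closed = gen⁻¹
    }

  -- x A x⁻¹
  conjugate : Carrier → Subgroup G → Subgroup G
  conjugate x A = record
    { Member    = λ y → ∃[ a ] Member a × y ≈ c a
    ; resp      = λ y≈z (a , p , eq) → a , p , trans (sym y≈z) eq
    ; ε-closed  = ε , ε-closed , sym c-ε
    ; ∙-closed  = λ (a , p , eq) (b , q , eq′) →
        a ∙ b , ∙-closed p q , trans (∙-cong eq eq′) (c-∙ a b)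
    ; ⁻¹-closed = λ (a , p , eq) →
        a ⁻¹ , ⁻¹-closed p , trans (⁻¹-cong eq) (c-⁻¹ a)
    }
    where
    open Subgroup A
    open SetoidReasoning setoid
    open import Algebra.Properties.Group G using (inverseʳ-unique)
    c : Carrier → Carrier
    c a = x ∙ a ∙ x ⁻¹
    c-ε : c ε ≈ ε
    c-ε = trans (∙-congʳ (identityʳ x)) (inverseʳ x)
    c-∙ : ∀ a b → c a ∙ c b ≈ c (a ∙ b)
    c-∙ a b = begin
      (x ∙ a ∙ x ⁻¹) ∙ (x ∙ b ∙ x ⁻¹)   ≈⟨ assoc _ _ _ ⟨
      (x ∙ a ∙ x ⁻¹) ∙ (x ∙ b) ∙ x ⁻¹   ≈⟨ ∙-congʳ (assoc _ _ _) ⟩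
      (x ∙ a) ∙ (x ⁻¹ ∙ (x ∙ b)) ∙ x ⁻¹ ≈⟨ ∙-congʳ (∙-congˡ (assoc _ _ _)) ⟨
      (x ∙ a) ∙ (x ⁻¹ ∙ x ∙ b) ∙ x ⁻¹
        ≈⟨ ∙-congʳ (∙-congˡ (trans (∙-congʳ (inverseˡ x)) (identityˡ b))) ⟩
      (x ∙ a) ∙ b ∙ x ⁻¹                ≈⟨ ∙-congʳ (assoc _ _ _) ⟩
      x ∙ (a ∙ b) ∙ x ⁻¹                ∎
    c-⁻¹ : ∀ a → c a ⁻¹ ≈ c (a ⁻¹)
    c-⁻¹ a = sym (inverseʳ-unique (c a) (c (a ⁻¹)) (begin
      c a ∙ c (a ⁻¹)  ≈⟨ c-∙ a (a ⁻¹) ⟩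
      c (a ∙ a ⁻¹)    ≈⟨ ∙-congʳ (∙-congˡ (inverseʳ a)) ⟩
      c ε             ≈⟨ c-ε ⟩
      ε               ∎))


-- Words over the disjoint union of the two carriers, modulo the congruence
-- generated by the multiplication tables of the two factors.
module FreeProduct {u} (G H : Group u u) where
  private
    module G = Group G
    module H = Group H

  Letter : Set u
  Letter = G.Carrier ⊎ H.Carrier

  Word : Set u
  Word = List Letter

  infix 4 _≋_
  data _≋_ : Rel Word u where
    refl    : ∀ {v} → v ≋ v
    sym     : ∀ {v w} → v ≋ w → w ≋ v
    trans   : ∀ {v w x} → v ≋ w → w ≋ x → v ≋ x
    ++-cong : ∀ {v v′ w w′} → v ≋ v′ → w ≋ w′ → v ++ w ≋ v′ ++ w′
    cong₁   : ∀ {x y} → x G.≈ y → inj₁ x ∷ [] ≋ inj₁ y ∷ []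
    cong₂   : ∀ {x y} → x H.≈ y → inj₂ x ∷ [] ≋ inj₂ y ∷ []
    mult₁   : ∀ x y → inj₁ x ∷ inj₁ y ∷ [] ≋ inj₁ (x G.∙ y) ∷ []
    mult₂   : ∀ x y → inj₂ x ∷ inj₂ y ∷ [] ≋ inj₂ (x H.∙ y) ∷ []
    unit₁   : inj₁ G.ε ∷ [] ≋ []
    unit₂   : inj₂ H.ε ∷ [] ≋ []

  invLetter : Letter → Letter
  invLetter (inj₁ x) = inj₁ (x G.⁻¹)
  invLetter (inj₂ x) = inj₂ (x H.⁻¹)

  inv : Word → Word
  inv []      = []
  inv (h ∷ w) = inv w ++ invLetter h ∷ []

  private
    ≡⇒≋ : ∀ {v w} → v ≡ w → v ≋ w
    ≡⇒≋ ≡.refl = refl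

    letterˡ : ∀ h → invLetter h ∷ h ∷ [] ≋ []
    letterˡ (inj₁ x) = trans (mult₁ _ _) (trans (cong₁ (G.inverseˡ x)) unit₁)
    letterˡ (inj₂ x) = trans (mult₂ _ _) (trans (cong₂ (H.inverseˡ x)) unit₂)

    letterʳ : ∀ h → h ∷ invLetter h ∷ [] ≋ []
    letterʳ (inj₁ x) = trans (mult₁ _ _) (trans (cong₁ (G.inverseʳ x)) unit₁)
    letterʳ (inj₂ x) = trans (mult₂ _ _) (trans (cong₂ (H.inverseʳ x)) unit₂)

    inv-inverseˡ : ∀ w → inv w ++ w ≋ []
    inv-inverseˡ []      = refl
    inv-inverseˡ (h ∷ w) =
      trans (≡⇒≋ (List.++-assoc (inv w) (invLetter h ∷ []) (h ∷ w)))
        (trans (++-cong (refl {inv w}) (++-cong (letterˡ h) (refl {w})))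
          (inv-inverseˡ w))

    inv-inverseʳ : ∀ w → w ++ inv w ≋ []
    inv-inverseʳ []      = refl
    inv-inverseʳ (h ∷ w) =
      trans (≡⇒≋ (≡.cong (h ∷_)
                (≡.sym (List.++-assoc w (inv w) (invLetter h ∷ [])))))
        (trans (++-cong (refl {h ∷ []})
                  (++-cong (inv-inverseʳ w) (refl {invLetter h ∷ []})))
          (letterʳ h))

    inv-cong : ∀ {v w} → v ≋ w → inv v ≋ inv w
    inv-cong {v} {w} p =
      trans (≡⇒≋ (≡.sym (List.++-identityʳ (inv v))))
        (trans (++-cong (refl {inv v}) (sym (inv-inverseʳ w)))
          (trans (++-cong (refl {inv v}) (++-cong (sym p) (refl {inv w})))
            (trans (≡⇒≋ (≡.sym (List.++-assoc (inv v) v (inv w))))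
              (++-cong (inv-inverseˡ v) (refl {inv w})))))

  group : Group u u
  group = record
    { Carrier = Word
    ; _≈_     = _≋_
    ; _∙_     = _++_
    ; ε       = []
    ; _⁻¹     = inv
    ; isGroup = record
      { isMonoid = record
        { isSemigroup = record
          { isMagma = record
            { isEquivalence = record { refl = refl ; sym = sym ; trans = trans }
            ; ∙-cong        = ++-cong
            }
          ; assoc = λ x y z → ≡⇒≋ (List.++-assoc x y z)
          }
        ; identity = (λ _ → refl) , (λ x → ≡⇒≋ (List.++-identityʳ x))
        }
      ; inverse = inv-inverseˡ , inv-inverseʳ
      ; ⁻¹-cong = inv-cong
      }
    }

  letter : Letter → Word
  letter h = h ∷ []

  ι₁ : G.Carrier → Word
  ι₁ x = letter (inj₁ x)

  ι₂ : H.Carrier → Word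
  ι₂ y = letter (inj₂ y)

  -- The map out of the free product induced by maps out of the two factors.
  module _ (K : Group u u) (f : G.Carrier → Group.Carrier K)
           (g : H.Carrier → Group.Carrier K) where
    private module K = Group K

    lift-letter : Letter → K.Carrier
    lift-letter (inj₁ x) = f x
    lift-letter (inj₂ y) = g y

    lift : Word → K.Carrier
    lift []      = K.ε
    lift (h ∷ w) = lift-letter h K.∙ lift w

    private
      module Hom₁ = GroupMorphisms G.rawGroup K.rawGroup
      module Hom₂ = GroupMorphisms H.rawGroup K.rawGroup

      lift-++ : ∀ v w → lift (v ++ w) K.≈ lift v K.∙ lift w
      lift-++ []      w = K.sym (K.identityˡ _)
      lift-++ (h ∷ v) w =
        K.trans (K.∙-congˡ (lift-++ v w)) (K.sym (K.assoc _ _ _))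

      one : ∀ {x y} → x K.≈ y → x K.∙ K.ε K.≈ y K.∙ K.ε
      one = K.∙-congʳ

    lift-cong : Hom₁.IsGroupHomomorphism f → Hom₂.IsGroupHomomorphism g →
                ∀ {v w} → v ≋ w → lift v K.≈ lift w
    lift-cong f-hom g-hom = go
      where
      module f = Hom₁.IsGroupHomomorphism f-hom
      module g = Hom₂.IsGroupHomomorphism g-hom
      go : ∀ {v w} → v ≋ w → lift v K.≈ lift w
      go refl        = K.refl
      go (sym p)     = K.sym (go p)
      go (trans p q) = K.trans (go p) (go q)
      go (++-cong {v} {v′} {w} {w′} p q) =
        K.trans (lift-++ v w)
          (K.trans (K.∙-cong (go p) (go q)) (K.sym (lift-++ v′ w′)))
      go (cong₁ p)   = one (f.⟦⟧-cong p)
      go (cong₂ p)   = one (g.⟦⟧-cong p)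
      go (mult₁ x y) =
        K.trans (K.sym (K.assoc _ _ _)) (one (K.sym (f.homo x y)))
      go (mult₂ x y) =
        K.trans (K.sym (K.assoc _ _ _)) (one (K.sym (g.homo x y)))
      go unit₁       = K.trans (one f.ε-homo) (K.identityʳ K.ε)
      go unit₂       = K.trans (one g.ε-homo) (K.identityʳ K.ε)


-- A group with a two-sided invariant metric.
record MetricGroup {u} (ℝ : CompleteOrderedField u) : Set (lsuc u) where
  private module ℝ = CompleteOrderedField ℝ
  field
    group : Group u u

  open Group group public

  field
    d          : Carrier → Carrier → ℝ.Carrier
    d-cong     : ∀ {x x′ y y′} → x ≈ x′ → y ≈ y′ → d x y ℝ.≈ d x′ y′
    nonNeg     : ∀ x y → ℝ.0# ℝ.≤ d x y
    d≈0⇒≈      : ∀ {x y} → d x y ℝ.≈ ℝ.0# → x ≈ y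
    ≈⇒d≈0      : ∀ {x y} → x ≈ y → d x y ℝ.≈ ℝ.0#
    symmetric  : ∀ x y → d x y ℝ.≈ d y x
    triangle   : ∀ x y z → d x z ℝ.≤ (d x y ℝ.+ d y z)
    invariantˡ : ∀ z x y → d (z ∙ x) (z ∙ y) ℝ.≈ d x y
    invariantʳ : ∀ z x y → d (x ∙ z) (y ∙ z) ℝ.≈ d x y

module _ {u} {ℝ : CompleteOrderedField u} (G : MetricGroup ℝ) where
  private module ℝ = CompleteOrderedField ℝ
  open MetricGroup G

  IsClosed : Subgroup group → Set u
  IsClosed A = ∀ x →
    (∀ ε → ℝ.0# ℝ.< ε → ∃[ a ] Member a × d x a ℝ.< ε) → Member x
    where open Subgroup A

  distances : Subgroup group → Pred ℝ.Carrier u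
  distances A r = ∃₂ λ a b → Member a × Member b × r ℝ.≈ d a b
    where open Subgroup A

  -- The diameter may be infinite, in which case the set of distances has no
  -- supremum in ℝ and the inequality fails.
  diam≤ : Subgroup group → ℝ.Carrier → Set u
  diam≤ A r = ∃[ D ] ℝ.IsSupremum (distances A) D × D ℝ.≤ r


module Graev {u} {ℝ : CompleteOrderedField u} (H₁ H₂ : MetricGroup ℝ) where
  private
    module ℝ  = CompleteOrderedField ℝ
    module H₁ = MetricGroup H₁
    module H₂ = MetricGroup H₂
  open FreeProduct H₁.group H₂.group

  -- The letters inj₁ ε and inj₂ ε both stand for the common unit of H₁ ∪ H₂;
  -- they are at distance 0 from each other and at the same distance from every
  -- other letter.
  d-letter : Letter → Letter → ℝ.Carrier
  d-letter (inj₁ x) (inj₁ y) = H₁.d x y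
  d-letter (inj₂ x) (inj₂ y) = H₂.d x y
  d-letter (inj₁ x) (inj₂ y) = H₁.d x H₁.ε ℝ.+ H₂.d H₂.ε y
  d-letter (inj₂ x) (inj₁ y) = H₂.d x H₂.ε ℝ.+ H₁.d H₁.ε y

  -- \hat α
  product : ∀ {n} → Vec Letter n → Word
  product = Vec.foldr′ (λ h w → letter h ++ w) []

  cost : ∀ {n} → Vec Letter n → Vec Letter n → ℝ.Carrier
  cost []       []       = ℝ.0#
  cost (x ∷ xs) (y ∷ ys) = d-letter x y ℝ.+ cost xs ys

  costs : Word → Word → Pred ℝ.Carrier u
  costs f₁ f₂ r = ∃[ n ] Σ (Vec Letter n) λ α₁ → Σ (Vec Letter n) λ α₂ →
    product α₁ ≋ f₁ × product α₂ ≋ f₂ × r ℝ.≈ cost α₁ α₂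

  private
    d-letter-nonNeg : ∀ x y → ℝ.0# ℝ.≤ d-letter x y
    d-letter-nonNeg (inj₁ x) (inj₁ y) = H₁.nonNeg x y
    d-letter-nonNeg (inj₂ x) (inj₂ y) = H₂.nonNeg x y
    d-letter-nonNeg (inj₁ x) (inj₂ y) = ℝ.+-nonNeg (H₁.nonNeg _ _) (H₂.nonNeg _ _)
    d-letter-nonNeg (inj₂ x) (inj₁ y) = ℝ.+-nonNeg (H₂.nonNeg _ _) (H₁.nonNeg _ _)

    cost-nonNeg : ∀ {n} (α β : Vec Letter n) → ℝ.0# ℝ.≤ cost α β
    cost-nonNeg []       []       = ℝ.≤.refl
    cost-nonNeg (x ∷ xs) (y ∷ ys) =
      ℝ.+-nonNeg (d-letter-nonNeg x y) (cost-nonNeg xs ys)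

    sameLength : ∀ f₁ f₂ → ∃[ n ] Σ (Vec Letter n) λ α₁ → Σ (Vec Letter n) λ α₂ →
                 product α₁ ≋ f₁ × product α₂ ≋ f₂
    sameLength []       []       = 0 , [] , [] , refl , refl
    sameLength (x ∷ f₁) []       =
      let n , α₁ , α₂ , p , q = sameLength f₁ []
      in suc n , x ∷ α₁ , inj₁ H₁.ε ∷ α₂ ,
         ++-cong (refl {letter x}) p , ++-cong unit₁ q
    sameLength []       (y ∷ f₂) =
      let n , α₁ , α₂ , p , q = sameLength [] f₂
      in suc n , inj₁ H₁.ε ∷ α₁ , y ∷ α₂ ,
         ++-cong unit₁ p , ++-cong (refl {letter y}) q
    sameLength (x ∷ f₁) (y ∷ f₂) =
      let n , α₁ , α₂ , p , q = sameLength f₁ f₂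
      in suc n , x ∷ α₁ , y ∷ α₂ ,
         ++-cong (refl {letter x}) p , ++-cong (refl {letter y}) q

    costs-infimum : ∀ f₁ f₂ → ∃ (ℝ.IsInfimum (costs f₁ f₂))
    costs-infimum f₁ f₂ = ℝ.infimum (costs f₁ f₂)
      (let n , α₁ , α₂ , p , q = sameLength f₁ f₂
       in cost α₁ α₂ , n , α₁ , α₂ , p , q , ℝ.refl)
      (ℝ.0# , λ (_ , α₁ , α₂ , _ , _ , eq) →
        ℝ.≤.≲-respʳ-≈ (ℝ.sym eq) (cost-nonNeg α₁ α₂))

  graev : Word → Word → ℝ.Carrier
  graev f₁ f₂ = proj₁ (costs-infimum f₁ f₂)

  graev-isInfimum : ∀ f₁ f₂ → ℝ.IsInfimum (costs f₁ f₂) (graev f₁ f₂)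
  graev-isInfimum f₁ f₂ = proj₂ (costs-infimum f₁ f₂)


-- The elements of ⟨t⟩ are the powers t^ m.
record ⟨t⟩ (u : Level) : Set u where
  constructor t^_
  field exponent : ℤ

⟨t⟩-group : ∀ u → Group u u
⟨t⟩-group u = record
  { Carrier = ⟨t⟩ u
  ; _≈_     = _≡_
  ; _∙_     = λ (t^ m) (t^ n) → t^ (m ℤ.+ n)
  ; ε       = t^ ℤ.0ℤ
  ; _⁻¹     = λ (t^ m) → t^ (ℤ.- m)
  ; isGroup = record
    { isMonoid = record
      { isSemigroup = record
        { isMagma = record
          { isEquivalence = ≡.isEquivalence
          ; ∙-cong        = ≡.cong₂ _
          }
        ; assoc = λ (t^ l) (t^ m) (t^ n) → ≡.cong t^_ (ℤ.+-assoc l m n)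
        }
      ; identity = (λ (t^ m) → ≡.cong t^_ (ℤ.+-identityˡ m))
                 , (λ (t^ m) → ≡.cong t^_ (ℤ.+-identityʳ m))
      }
    ; inverse = (λ (t^ m) → ≡.cong t^_ (ℤ.+-inverseˡ m))
              , (λ (t^ m) → ≡.cong t^_ (ℤ.+-inverseʳ m))
    ; ⁻¹-cong = λ { ≡.refl → ≡.refl }
    }
  }

⟨t⟩-metricGroup : ∀ {u} (ℝ : CompleteOrderedField u) → MetricGroup ℝ
⟨t⟩-metricGroup {u} ℝ = record
  { group      = ⟨t⟩-group u
  ; d          = λ (t^ m) (t^ n) → ℝ.fromℕ ∣ m ℤ.- n ∣
  ; d-cong     = λ where ≡.refl ≡.refl → ℝ.refl
  ; nonNeg     = λ (t^ m) (t^ n) → ℝ.fromℕ-nonNeg ∣ m ℤ.- n ∣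
  ; d≈0⇒≈      = λ { {t^ m} {t^ n} p → ≡.cong t^_
                   (ℤ.i-j≡0⇒i≡j m n (ℤ.∣i∣≡0⇒i≡0 (ℝ.fromℕ≈0 _ p))) }
  ; ≈⇒d≈0      = λ { {t^ m} ≡.refl →
                   ℝ.reflexive (≡.cong (ℝ.fromℕ ∘ ∣_∣) (ℤ.+-inverseʳ m)) }
  ; symmetric  = λ (t^ m) (t^ n) → ℝ.reflexive (≡.cong ℝ.fromℕ (ℤ.∣i-j∣≡∣j-i∣ m n))
  ; triangle   = λ (t^ l) (t^ m) (t^ n) →
      ℝ.≤.≲-respʳ-≈ (ℝ.fromℕ-homo-+ ∣ l ℤ.- m ∣ ∣ m ℤ.- n ∣)
        (ℝ.fromℕ-mono-≤ (≡.subst (λ i → ∣ i ∣ ℕ.≤ ∣ l ℤ.- m ∣ ℕ.+ ∣ m ℤ.- n ∣)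
          (telescope l m n) (ℤ.∣i+j∣≤∣i∣+∣j∣ (l ℤ.- m) (m ℤ.- n))))
  ; invariantˡ = λ (t^ l) (t^ m) (t^ n) →
      ℝ.reflexive (≡.cong (ℝ.fromℕ ∘ ∣_∣) (cancelˡ l m n))
  ; invariantʳ = λ (t^ l) (t^ m) (t^ n) →
      ℝ.reflexive (≡.cong (ℝ.fromℕ ∘ ∣_∣) (cancelʳ l m n))
  }
  where
  module ℝ = CompleteOrderedField ℝ
  telescope : ∀ l m n → (l ℤ.- m) ℤ.+ (m ℤ.- n) ≡ l ℤ.- n
  telescope = ℤ-Solver.solve-∀
  cancelˡ : ∀ l m n → (l ℤ.+ m) ℤ.- (l ℤ.+ n) ≡ m ℤ.- n
  cancelˡ = ℤ-Solver.solve-∀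
  cancelʳ : ∀ l m n → (m ℤ.+ l) ℤ.- (n ℤ.+ l) ≡ m ℤ.- n
  cancelʳ = ℤ-Solver.solve-∀


module Conjugation {u} {ℝ : CompleteOrderedField u} (G : MetricGroup ℝ)
                   (A : Subgroup (MetricGroup.group G)) where
  private
    module ℝ = CompleteOrderedField ℝ
    module G = MetricGroup G

  private module G*⟨t⟩ = FreeProduct G.group (⟨t⟩-group u)

  G*⟨t⟩ : Group u u
  G*⟨t⟩ = G*⟨t⟩.group

  d : Group.Carrier G*⟨t⟩ → Group.Carrier G*⟨t⟩ → ℝ.Carrier
  d = Graev.graev G (⟨t⟩-metricGroup ℝ)

  t : Group.Carrier G*⟨t⟩
  t = G*⟨t⟩.ι₂ (t^ ℤ.1ℤ)

  embed : G.Carrier → Group.Carrier G*⟨t⟩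
  embed = G*⟨t⟩.ι₁

  -- A as a subgroup of G * ⟨t⟩
  embeddedA : Subgroup G*⟨t⟩
  embeddedA = record
    { Member    = λ x → ∃[ a ] Member a × x G*⟨t⟩.≋ embed a
    ; resp      = λ x≈y (a , p , eq) → a , p , G*⟨t⟩.trans (G*⟨t⟩.sym x≈y) eq
    ; ε-closed  = G.ε , ε-closed , G*⟨t⟩.sym G*⟨t⟩.unit₁
    ; ∙-closed  = λ (a , p , eq) (b , q , eq′) → a G.∙ b , ∙-closed p q ,
        G*⟨t⟩.trans (G*⟨t⟩.++-cong eq eq′) (G*⟨t⟩.mult₁ a b)
    ; ⁻¹-closed = λ (a , p , eq) → a G.⁻¹ , ⁻¹-closed p ,
        Group.⁻¹-cong G*⟨t⟩ eq
    }
    where open Subgroup A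

  tAt⁻¹ : Subgroup G*⟨t⟩
  tAt⁻¹ = conjugate G*⟨t⟩ t embeddedA

  private
    module T = Group (⟨t⟩-group u)

    -- G * ⟨t⟩ → G, killing t
    retract : Group.Carrier G*⟨t⟩ → G.Carrier
    retract = G*⟨t⟩.lift G.group id (λ _ → G.ε)

    retract-cong : ∀ {v w} → v G*⟨t⟩.≋ w → retract v G.≈ retract w
    retract-cong = G*⟨t⟩.lift-cong G.group id (λ _ → G.ε)
      (Identity.isGroupHomomorphism G.rawGroup G.refl)
      (record
        { isMonoidHomomorphism = record
          { isMagmaHomomorphism = record
            { isRelHomomorphism = record { cong = λ _ → G.refl }
            ; homo              = λ _ _ → G.sym (G.identityˡ G.ε)
            }
          ; ε-homo = G.refl
          }
        ; ⁻¹-homo = λ _ → G.sym ε⁻¹≈ε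
        })
      where open import Algebra.Properties.Group G.group using (ε⁻¹≈ε)

  -- The element a of A with x = t a t⁻¹
  conjugand : Σ (Group.Carrier G*⟨t⟩) (Subgroup.Member tAt⁻¹) → G.Carrier
  conjugand (x , b , (a , _ , b≈a) , x≈tbt⁻¹) = a

  private
    retract-conjugand : ∀ x → retract (proj₁ x) G.≈ conjugand x
    retract-conjugand (x , b , (a , _ , b≈a) , x≈tbt⁻¹) =
      G.trans (retract-cong (G*⟨t⟩.trans x≈tbt⁻¹
        (G*⟨t⟩.++-cong (G*⟨t⟩.++-cong (G*⟨t⟩.refl {t}) b≈a) G*⟨t⟩.refl)))
        (G.trans (G.identityˡ _)
          (G.trans (G.∙-congˡ (G.identityˡ G.ε)) (G.identityʳ a)))

    conjugand-cong : ∀ {x y} → proj₁ x G*⟨t⟩.≋ proj₁ y →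
                     conjugand x G.≈ conjugand y
    conjugand-cong {x} {y} p = G.trans (G.sym (retract-conjugand x))
      (G.trans (retract-cong p) (retract-conjugand y))

    conjugand-injective : ∀ {x y} → conjugand x G.≈ conjugand y →
                          proj₁ x G*⟨t⟩.≋ proj₁ y
    conjugand-injective {x , b , (a , _ , b≈a) , x≈} {y , c , (a′ , _ , c≈a′) , y≈} p =
      G*⟨t⟩.trans x≈ (G*⟨t⟩.trans
        (G*⟨t⟩.++-cong (G*⟨t⟩.++-cong (G*⟨t⟩.refl {t})
          (G*⟨t⟩.trans b≈a (G*⟨t⟩.trans (G*⟨t⟩.cong₁ p) (G*⟨t⟩.sym c≈a′))))
          G*⟨t⟩.refl)
        (G*⟨t⟩.sym y≈))

  tAt⁻¹-metricGroup : MetricGroup ℝ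
  tAt⁻¹-metricGroup = record
    { group      = Subgroup.group tAt⁻¹
    ; d          = λ x y → G.d (conjugand x) (conjugand y)
    ; d-cong     = λ {x} {x′} {y} {y′} p q →
        G.d-cong (conjugand-cong {x} {x′} p) (conjugand-cong {y} {y′} q)
    ; nonNeg     = λ x y → G.nonNeg (conjugand x) (conjugand y)
    ; d≈0⇒≈      = λ {x} {y} p → conjugand-injective {x} {y} (G.d≈0⇒≈ p)
    ; ≈⇒d≈0      = λ {x} {y} p → G.≈⇒d≈0 (conjugand-cong {x} {y} p)
    ; symmetric  = λ x y → G.symmetric (conjugand x) (conjugand y)
    ; triangle   = λ x y z → G.triangle (conjugand x) (conjugand y) (conjugand z)
    ; invariantˡ = λ z x y → G.invariantˡ (conjugand z) (conjugand x) (conjugand y)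
    ; invariantʳ = λ z x y → G.invariantʳ (conjugand z) (conjugand x) (conjugand y)
    }

  private module G*tAt⁻¹ = FreeProduct G.group (Subgroup.group tAt⁻¹)

  G*tAt⁻¹ : Group u u
  G*tAt⁻¹ = G*tAt⁻¹.group

  d̲ : Group.Carrier G*tAt⁻¹ → Group.Carrier G*tAt⁻¹ → ℝ.Carrier
  d̲ = Graev.graev G tAt⁻¹-metricGroup

  image-G : Pred (Group.Carrier G*⟨t⟩) u
  image-G x = ∃[ g ] x G*⟨t⟩.≋ embed g

  ⟨G∪tAt⁻¹⟩ : Subgroup G*⟨t⟩
  ⟨G∪tAt⁻¹⟩ = subgroupGeneratedBy G*⟨t⟩ (image-G ∪ Subgroup.Member tAt⁻¹)

  -- Induced by the inclusions of G and tAt⁻¹ into G * ⟨t⟩.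
  canonical : Group.Carrier G*tAt⁻¹ → Group.Carrier (Subgroup.group ⟨G∪tAt⁻¹⟩)
  canonical = G*tAt⁻¹.lift (Subgroup.group ⟨G∪tAt⁻¹⟩)
    (λ g → embed g , gen∈ (inj₁ (g , G*⟨t⟩.refl)))
    (λ (x , p) → x , gen∈ (inj₂ p))

  canonical-isIsomorphism : Set u
  canonical-isIsomorphism = IsGroupIsomorphism canonical
    where
    open GroupMorphisms (Group.rawGroup G*tAt⁻¹)
                        (Group.rawGroup (Subgroup.group ⟨G∪tAt⁻¹⟩))

  -- d | G * tAt⁻¹
  d| : Group.Carrier G*tAt⁻¹ → Group.Carrier G*tAt⁻¹ → ℝ.Carrier
  d| f₁ f₂ = d (proj₁ (canonical f₁)) (proj₁ (canonical f₂))

{-# OPTIONS --safe #-}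

-- The distance of two elements of a free product is the least price of destroying
-- a word for their quotient, where adjacent letters of one factor are multiplied
-- for free and deleting a letter costs its norm; the price depends only on the
-- element, since a strategy for one word can be followed on any equivalent word.
-- Suppose that diam A ≤ 1 and destroy the expansion g₀ (t a₁ t⁻¹) g₁ (t a₂ t⁻¹) … of
-- a word over G and tAt⁻¹. Deletions of t and t⁻¹ come in pairs on the same level
-- of nesting, and such a pair costs 2. This pays for moving the enclosed letters
-- t a t⁻¹ to a ∈ G, which costs at most ∥a∥ + ∥a∥ ≤ 2 in G * tAt⁻¹, so the strategy can
-- be imitated there. With the discrete metric on G the same argument shows that
-- G * tAt⁻¹ embeds into G * ⟨t⟩.
-- Conversely, a and t a t⁻¹ are at distance at most 2 in G * ⟨t⟩, as one sees by
-- deleting t and t⁻¹, and at distance 2 ∥a∥ in G * tAt⁻¹, as one sees by projecting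
-- to the two factors.
module Submission where

open import Defs
open import Algebra.Bundles using (Group)
import Algebra.Morphism.Construct.Identity as Identity
open import Algebra.Morphism.Structures using (module GroupMorphisms)
import Algebra.Properties.Group as GroupProperties
import Algebra.Properties.CommutativeSemigroup as CommutativeSemigroupProperties
open import Axiom.ExcludedMiddle using (ExcludedMiddle)
open import Data.List.Base using (List; []; _∷_; _++_; replicate)
import Data.List.Properties as List
open import Data.Integer.Base as ℤ using (ℤ; +_; -[1+_]; ∣_∣)
import Data.Integer.Properties as ℤ
open import Data.Nat.Base as ℕ using (ℕ; zero; suc)
open import Data.Product.Base using (∃-syntax; _×_; _,_; proj₁; proj₂; swap; map₂)
open import Data.Sum.Base using (inj₁; inj₂)
open import Data.Unit.Polymorphic.Base using (⊤; tt)
open import Data.Vec.Base as Vec using (Vec; []; _∷_)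
open import Function.Base using (id)
open import Function.Bundles using (_⇔_; mk⇔)
open import Relation.Binary.Bundles using (Poset)
open import Relation.Binary.PropositionalEquality as ≡ using (_≡_)
import Relation.Binary.Reasoning.PartialOrder as PosetReasoning
open import Relation.Nullary.Decidable.Core using (Dec; yes; no)
open import Relation.Nullary.Negation using (contradiction)

-- Order and addition in the real field.

module Real {u} (ℝ : CompleteOrderedField u) where
  open CompleteOrderedField ℝ
  open CommutativeSemigroupProperties +-commutativeSemigroup public
    using (interchange)

  poset : Poset u u u
  poset = record { isPartialOrder = ≤.isPartialOrder }

  module ≤-Reasoning = PosetReasoning poset

  +-mono-≤ : ∀ {w x y z} → w ≤ x → y ≤ z → w + y ≤ x + z
  +-mono-≤ {x = x} {y} p q = ≤.trans (+-monoˡ-≤ y p) (+-monoʳ-≤ x q)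

  x≤y+x : ∀ {x y} → 0# ≤ y → x ≤ y + x
  x≤y+x {x} p = ≤.≲-respˡ-≈ (+-identityˡ x) (+-monoˡ-≤ x p)

  x≤x+y : ∀ {x y} → 0# ≤ y → x ≤ x + y
  x≤x+y {x} p = ≤.≲-respˡ-≈ (+-identityʳ x) (+-monoʳ-≤ x p)

  0+x≤x : ∀ {x} → 0# + x ≤ x
  0+x≤x = ≤.reflexive (+-identityˡ _)

  x+0≤x : ∀ {x} → x + 0# ≤ x
  x+0≤x = ≤.reflexive (+-identityʳ _)

  +-cancelʳ-≤ : ∀ z {x y} → x + z ≤ y + z → x ≤ y
  +-cancelʳ-≤ z {x} {y} p =
    ≤.≲-respˡ-≈ (cancel x) (≤.≲-respʳ-≈ (cancel y) (+-monoˡ-≤ (- z) p))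
    where
    cancel : ∀ w → w + z + - z ≈ w
    cancel w = trans (+-assoc w z (- z)) (trans (+-congˡ (-‿inverseʳ z)) (+-identityʳ w))

  x+x≤y+y⇒x≤y : ∀ {x y} → x + x ≤ y + y → x ≤ y
  x+x≤y+y⇒x≤y {x} {y} p with ≤.total x y
  ... | inj₁ x≤y = x≤y
  ... | inj₂ y≤x = +-cancelʳ-≤ y (≤.trans (+-monoʳ-≤ x y≤x) p)

  x+y≤0⇒x≤0 : ∀ {x y} → 0# ≤ y → x + y ≤ 0# → x ≤ 0#
  x+y≤0⇒x≤0 q p = ≤.trans (x≤x+y q) p

  x+y≤0⇒y≤0 : ∀ {x y} → 0# ≤ x → x + y ≤ 0# → y ≤ 0#
  x+y≤0⇒y≤0 q p = ≤.trans (x≤y+x q) p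

-- Norms in a group with a two-sided invariant metric.

module Metric {u} {ℝ : CompleteOrderedField u} (M : MetricGroup ℝ) where
  private module ℝ = CompleteOrderedField ℝ
  open MetricGroup M
  open Real ℝ

  ∥_∥ : Carrier → ℝ.Carrier
  ∥ x ∥ = d x ε

  d-refl : ∀ {x} → d x x ℝ.≈ ℝ.0#
  d-refl = ≈⇒d≈0 refl

  d≤0⇒≈ : ∀ {x y} → d x y ℝ.≤ ℝ.0# → x ≈ y
  d≤0⇒≈ p = d≈0⇒≈ (ℝ.≤.antisym p (nonNeg _ _))

  d-sandwich : ∀ a b {x y} → d (a ∙ x ∙ b) (a ∙ y ∙ b) ℝ.≈ d x y
  d-sandwich a b = ℝ.trans (invariantʳ b _ _) (invariantˡ a _ _)

  d-∙ʳ : ∀ x y → d (x ∙ y) y ℝ.≈ ∥ x ∥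
  d-∙ʳ x y = ℝ.trans (d-cong refl (sym (identityˡ y))) (invariantʳ y x ε)

  d-∙ˡ : ∀ x y → d (x ∙ y) x ℝ.≈ ∥ y ∥
  d-∙ˡ x y = ℝ.trans (d-cong refl (sym (identityʳ x))) (invariantˡ x y ε)

  ∥x∙y⁻¹∥ : ∀ x y → ∥ x ∙ y ⁻¹ ∥ ℝ.≈ d x y
  ∥x∙y⁻¹∥ x y =
    ℝ.trans (d-cong refl (sym (inverseʳ y))) (invariantʳ (y ⁻¹) x y)

  ∥x⁻¹∥ : ∀ x → ∥ x ⁻¹ ∥ ℝ.≈ d ε x
  ∥x⁻¹∥ x = ℝ.trans (d-cong (sym (identityˡ (x ⁻¹))) refl) (∥x∙y⁻¹∥ ε x)

  d-∙-≤ : ∀ w x y z → d (w ∙ x) (y ∙ z) ℝ.≤ d w y ℝ.+ d x z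
  d-∙-≤ w x y z = ℝ.≤.trans (triangle (w ∙ x) (y ∙ x) (y ∙ z))
    (+-mono-≤ (ℝ.≤.reflexive (invariantʳ x w y)) (ℝ.≤.reflexive (invariantˡ y x z)))

-- The Graev metric through attained costs.

-- Within f g c says that some pair of words witnesses graev f g ≤ c.
module Distance {u} {ℝ : CompleteOrderedField u} (H₁ H₂ : MetricGroup ℝ) where
  private
    module ℝ  = CompleteOrderedField ℝ
    module H₁ = MetricGroup H₁
    module H₂ = MetricGroup H₂
    module M₁ = Metric H₁
    module M₂ = Metric H₂
  open Real ℝ
  open FreeProduct H₁.group H₂.group
  open Graev H₁ H₂
  private module F = Group group

  Within : Word → Word → ℝ.Carrier → Set u
  Within f g c = ∃[ r ] costs f g r × r ℝ.≤ c

  within-weaken : ∀ {f g b c} → b ℝ.≤ c → Within f g b → Within f g c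
  within-weaken b≤c (r , p , r≤b) = r , p , ℝ.≤.trans r≤b b≤c

  within-resp : ∀ {f f′ g g′ c} → f ≋ f′ → g ≋ g′ → Within f g c → Within f′ g′ c
  within-resp f≋ g≋ (r , (n , α , β , p , q , eq) , le) =
    r , (n , α , β , trans p f≋ , trans q g≋ , eq) , le

  product-++ : ∀ {m n} (α : Vec Letter m) (β : Vec Letter n) →
               product (α Vec.++ β) ≡ product α ++ product β
  product-++ []      β = ≡.refl
  product-++ (x ∷ α) β = ≡.cong (x ∷_) (product-++ α β)

  cost-++ : ∀ {m n} (α β : Vec Letter m) (γ δ : Vec Letter n) →
            cost (α Vec.++ γ) (β Vec.++ δ) ℝ.≈ cost α β ℝ.+ cost γ δ
  cost-++ []      []      γ δ = ℝ.sym (ℝ.+-identityˡ _)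
  cost-++ (x ∷ α) (y ∷ β) γ δ =
    ℝ.trans (ℝ.+-congˡ (cost-++ α β γ δ)) (ℝ.sym (ℝ.+-assoc _ _ _))

  within-++ : ∀ {f f′ g g′ b c} → Within f g b → Within f′ g′ c →
              Within (f ++ f′) (g ++ g′) (b ℝ.+ c)
  within-++ (_ , (_ , α , β , p , q , eq) , le) (_ , (_ , γ , δ , p′ , q′ , eq′) , le′) =
    _ , (_ , α Vec.++ γ , β Vec.++ δ
        , trans (F.reflexive (product-++ α γ)) (++-cong p p′)
        , trans (F.reflexive (product-++ β δ)) (++-cong q q′)
        , ℝ.sym (cost-++ α β γ δ))
      , ℝ.≤.trans (ℝ.≤.reflexive (ℝ.+-cong (ℝ.sym eq) (ℝ.sym eq′))) (+-mono-≤ le le′)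

  within-letter : ∀ x y {c} → d-letter x y ℝ.≤ c → Within (letter x) (letter y) c
  within-letter x y le =
    _ , (1 , x ∷ [] , y ∷ [] , refl , refl , ℝ.refl) , ℝ.≤.trans x+0≤x le

  within-[] : ∀ {c} → ℝ.0# ℝ.≤ c → Within [] [] c
  within-[] le = _ , (0 , [] , [] , refl , refl , ℝ.refl) , le

  d-letter-refl : ∀ x → d-letter x x ℝ.≈ ℝ.0#
  d-letter-refl (inj₁ _) = M₁.d-refl
  d-letter-refl (inj₂ _) = M₂.d-refl

  within-refl : ∀ f → Within f f ℝ.0#
  within-refl []      = within-[] ℝ.≤.refl
  within-refl (x ∷ f) = within-weaken 0+x≤x
    (within-++ (within-letter x x (ℝ.≤.reflexive (d-letter-refl x))) (within-refl f))

  within-≋ : ∀ {f g} → f ≋ g → Within f g ℝ.0#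
  within-≋ {f} p = within-resp refl p (within-refl f)

  within-++ˡ : ∀ f {g h c} → Within g h c → Within (f ++ g) (f ++ h) c
  within-++ˡ f w = within-weaken 0+x≤x (within-++ (within-refl f) w)

  within-++ʳ : ∀ f {g h c} → Within g h c → Within (g ++ f) (h ++ f) c
  within-++ʳ f w = within-weaken x+0≤x (within-++ w (within-refl f))

  -- f = f g⁻¹ g and h = g g⁻¹ h are compared factor by factor.
  within-trans : ∀ {f g h b c} → Within f g b → Within g h c → Within f h (b ℝ.+ c)
  within-trans {f} {g} {h} p q = within-resp
    (trans (F.assoc f (inv g) g)
      (trans (++-cong refl (F.inverseˡ g)) (F.identityʳ f)))
    (++-cong (F.inverseʳ g) refl)
    (within-++ (within-++ʳ (inv g) p) q)

  graev-≤ : ∀ {f g c} → Within f g c → graev f g ℝ.≤ c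
  graev-≤ {f} {g} (_ , p , le) = ℝ.≤.trans (proj₁ (graev-isInfimum f g) p) le

  ≤-graev : ∀ {f g x} → (∀ {r} → costs f g r → x ℝ.≤ r) → x ℝ.≤ graev f g
  ≤-graev {f} {g} = proj₂ (graev-isInfimum f g)

  d-letter-nonNeg : ∀ x y → ℝ.0# ℝ.≤ d-letter x y
  d-letter-nonNeg (inj₁ x) (inj₁ y) = H₁.nonNeg x y
  d-letter-nonNeg (inj₂ x) (inj₂ y) = H₂.nonNeg x y
  d-letter-nonNeg (inj₁ x) (inj₂ y) = ℝ.+-nonNeg (H₁.nonNeg _ _) (H₂.nonNeg _ _)
  d-letter-nonNeg (inj₂ x) (inj₁ y) = ℝ.+-nonNeg (H₂.nonNeg _ _) (H₁.nonNeg _ _)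

  cost-nonNeg : ∀ {n} (α β : Vec Letter n) → ℝ.0# ℝ.≤ cost α β
  cost-nonNeg []      []      = ℝ.≤.refl
  cost-nonNeg (x ∷ α) (y ∷ β) = ℝ.+-nonNeg (d-letter-nonNeg x y) (cost-nonNeg α β)

  d-letter≤0⇒≋ : ∀ x y → d-letter x y ℝ.≤ ℝ.0# → letter x ≋ letter y
  d-letter≤0⇒≋ (inj₁ x) (inj₁ y) p = cong₁ (M₁.d≤0⇒≈ p)
  d-letter≤0⇒≋ (inj₂ x) (inj₂ y) p = cong₂ (M₂.d≤0⇒≈ p)
  -- Letters of different factors at distance 0 are both units, hence both equal to the empty word.
  d-letter≤0⇒≋ (inj₁ x) (inj₂ y) p =
    trans (trans (cong₁ (M₁.d≤0⇒≈ (x+y≤0⇒x≤0 (H₂.nonNeg _ _) p))) unit₁)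
      (trans (sym unit₂) (cong₂ (M₂.d≤0⇒≈ (x+y≤0⇒y≤0 (H₁.nonNeg _ _) p))))
  d-letter≤0⇒≋ (inj₂ x) (inj₁ y) p =
    trans (trans (cong₂ (M₂.d≤0⇒≈ (x+y≤0⇒x≤0 (H₁.nonNeg _ _) p))) unit₂)
      (trans (sym unit₁) (cong₁ (M₁.d≤0⇒≈ (x+y≤0⇒y≤0 (H₂.nonNeg _ _) p))))

  cost≤0⇒≋ : ∀ {n} (α β : Vec Letter n) → cost α β ℝ.≤ ℝ.0# → product α ≋ product β
  cost≤0⇒≋ []      []      _ = refl
  cost≤0⇒≋ (x ∷ α) (y ∷ β) p = ++-cong
    (d-letter≤0⇒≋ x y (x+y≤0⇒x≤0 (cost-nonNeg α β) p))
    (cost≤0⇒≋ α β (x+y≤0⇒y≤0 (d-letter-nonNeg x y) p))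

  -- The cost is attained by a pair of words, so corresponding letters are at distance 0; an infimum
  -- equal to 0 would not give this directly. Injectivity of `image` rests on it.
  within-0⇒≋ : ∀ {f g} → Within f g ℝ.0# → f ≋ g
  within-0⇒≋ (_ , (_ , α , β , p , q , eq) , le) =
    trans (sym p) (trans (cost≤0⇒≋ α β (ℝ.≤.≲-respˡ-≈ eq le)) q)

  -- Projections to the two factors.

  private
    trivial-hom : ∀ {X Y : Group u u} →
      GroupMorphisms.IsGroupHomomorphism (Group.rawGroup X) (Group.rawGroup Y) (λ _ → Group.ε Y)
    trivial-hom {Y = Y} = record
      { isMonoidHomomorphism = record
        { isMagmaHomomorphism = record
          { isRelHomomorphism = record { cong = λ _ → Y.refl }
          ; homo              = λ _ _ → Y.sym (Y.identityˡ Y.ε)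
          }
        ; ε-homo = Y.refl
        }
      ; ⁻¹-homo = λ _ → Y.sym (GroupProperties.ε⁻¹≈ε Y)
      }
      where module Y = Group Y

  project₁ : Word → H₁.Carrier
  project₁ = lift H₁.group id (λ _ → H₁.ε)

  project₂ : Word → H₂.Carrier
  project₂ = lift H₂.group (λ _ → H₂.ε) id

  project₁-cong : ∀ {f g} → f ≋ g → project₁ f H₁.≈ project₁ g
  project₁-cong = lift-cong H₁.group id (λ _ → H₁.ε)
    (Identity.isGroupHomomorphism H₁.rawGroup H₁.refl) (trivial-hom {H₂.group} {H₁.group})

  project₂-cong : ∀ {f g} → f ≋ g → project₂ f H₂.≈ project₂ g
  project₂-cong = lift-cong H₂.group (λ _ → H₂.ε) id
    (trivial-hom {H₁.group} {H₂.group}) (Identity.isGroupHomomorphism H₂.rawGroup H₂.refl)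

  private
    letter₁ : Letter → H₁.Carrier
    letter₁ = lift-letter H₁.group id (λ _ → H₁.ε)

    letter₂ : Letter → H₂.Carrier
    letter₂ = lift-letter H₂.group (λ _ → H₂.ε) id

  -- A letter becomes the unit in the factor to which it does not belong, so the metric on the
  -- alphabet is an ℓ¹ sum over the two projections.
  d-letter-project : ∀ x y →
    d-letter x y ℝ.≈ H₁.d (letter₁ x) (letter₁ y) ℝ.+ H₂.d (letter₂ x) (letter₂ y)
  d-letter-project (inj₁ x) (inj₁ y) =
    ℝ.sym (ℝ.trans (ℝ.+-congˡ M₂.d-refl) (ℝ.+-identityʳ _))
  d-letter-project (inj₂ x) (inj₂ y) =
    ℝ.sym (ℝ.trans (ℝ.+-congʳ M₁.d-refl) (ℝ.+-identityˡ _))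
  d-letter-project (inj₁ x) (inj₂ y) = ℝ.refl
  d-letter-project (inj₂ x) (inj₁ y) = ℝ.+-comm _ _

  cost-project : ∀ {n} (α β : Vec Letter n) →
    H₁.d (project₁ (product α)) (project₁ (product β)) ℝ.+
    H₂.d (project₂ (product α)) (project₂ (product β)) ℝ.≤ cost α β
  cost-project []      []      =
    ℝ.≤.reflexive (ℝ.trans (ℝ.+-cong M₁.d-refl M₂.d-refl) (ℝ.+-identityˡ _))
  cost-project (x ∷ α) (y ∷ β) = begin
    H₁.d (x₁ H₁.∙ α₁) (y₁ H₁.∙ β₁) ℝ.+ H₂.d (x₂ H₂.∙ α₂) (y₂ H₂.∙ β₂)
      ≤⟨ +-mono-≤ (M₁.d-∙-≤ x₁ α₁ y₁ β₁) (M₂.d-∙-≤ x₂ α₂ y₂ β₂) ⟩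
    (H₁.d x₁ y₁ ℝ.+ H₁.d α₁ β₁) ℝ.+ (H₂.d x₂ y₂ ℝ.+ H₂.d α₂ β₂)
      ≈⟨ interchange _ _ _ _ ⟩
    (H₁.d x₁ y₁ ℝ.+ H₂.d x₂ y₂) ℝ.+ (H₁.d α₁ β₁ ℝ.+ H₂.d α₂ β₂)
      ≤⟨ +-mono-≤ (ℝ.≤.reflexive (ℝ.sym (d-letter-project x y))) (cost-project α β) ⟩
    d-letter x y ℝ.+ cost α β   ∎
    where
    open ≤-Reasoning
    x₁ = letter₁ x
    y₁ = letter₁ y
    x₂ = letter₂ x
    y₂ = letter₂ y
    α₁ = project₁ (product α)
    β₁ = project₁ (product β)
    α₂ = project₂ (product α)
    β₂ = project₂ (product β)

  project-≤-graev : ∀ f g →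
    H₁.d (project₁ f) (project₁ g) ℝ.+ H₂.d (project₂ f) (project₂ g) ℝ.≤ graev f g
  project-≤-graev f g = ≤-graev λ (_ , α , β , p , q , eq) →
    ℝ.≤.≲-respʳ-≈ (ℝ.sym eq) (ℝ.≤.≲-respˡ-≈
      (ℝ.+-cong (H₁.d-cong (project₁-cong p) (project₁-cong q))
                (H₂.d-cong (project₂-cong p) (project₂-cong q)))
      (cost-project α β))

-- Destroying words at a price.

-- Words are destroyed by multiplying adjacent letters of the same factor for
-- free and deleting letters at the price of their norm.
module Collapse {u} {ℝ : CompleteOrderedField u} (H₁ H₂ : MetricGroup ℝ) where
  private
    module ℝ  = CompleteOrderedField ℝ
    module H₁ = MetricGroup H₁
    module H₂ = MetricGroup H₂
    module M₁ = Metric H₁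
    module M₂ = Metric H₂
  open Real ℝ
  open FreeProduct H₁.group H₂.group
  open Graev H₁ H₂
  private module F = Group group

  norm : Letter → ℝ.Carrier
  norm (inj₁ x) = M₁.∥ x ∥
  norm (inj₂ x) = M₂.∥ x ∥

  norm-nonNeg : ∀ x → ℝ.0# ℝ.≤ norm x
  norm-nonNeg (inj₁ x) = H₁.nonNeg x _
  norm-nonNeg (inj₂ x) = H₂.nonNeg x _

  data Mul : Letter → Letter → Letter → Set u where
    mul₁ : ∀ {x y z} → z H₁.≈ x H₁.∙ y → Mul (inj₁ x) (inj₁ y) (inj₁ z)
    mul₂ : ∀ {x y z} → z H₂.≈ x H₂.∙ y → Mul (inj₂ x) (inj₂ y) (inj₂ z)

  data Near (c : ℝ.Carrier) : Letter → Letter → Set u where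
    near₁ : ∀ {x y} → H₁.d x y ℝ.≤ c → Near c (inj₁ x) (inj₁ y)
    near₂ : ∀ {x y} → H₂.d x y ℝ.≤ c → Near c (inj₂ x) (inj₂ y)

  near-sym : ∀ {c x y} → Near c x y → Near c y x
  near-sym (near₁ p) = near₁ (ℝ.≤.≲-respˡ-≈ (H₁.symmetric _ _) p)
  near-sym (near₂ p) = near₂ (ℝ.≤.≲-respˡ-≈ (H₂.symmetric _ _) p)

  near-weaken : ∀ {b c x y} → b ℝ.≤ c → Near b x y → Near c x y
  near-weaken le (near₁ p) = near₁ (ℝ.≤.trans p le)
  near-weaken le (near₂ p) = near₂ (ℝ.≤.trans p le)

  near-norm : ∀ {c x y} → Near c x y → norm x ℝ.≤ c ℝ.+ norm y
  near-norm (near₁ p) = ℝ.≤.trans (H₁.triangle _ _ _) (ℝ.+-monoˡ-≤ _ p)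
  near-norm (near₂ p) = ℝ.≤.trans (H₂.triangle _ _ _) (ℝ.+-monoˡ-≤ _ p)

  near-mulˡ : ∀ {c x y y′ z} → Near c y′ y → Mul x y z →
              ∃[ z′ ] Mul x y′ z′ × Near c z′ z
  near-mulˡ (near₁ p) (mul₁ m) = _ , mul₁ H₁.refl ,
    near₁ (ℝ.≤.≲-respˡ-≈ (ℝ.sym (ℝ.trans (H₁.d-cong H₁.refl m) (H₁.invariantˡ _ _ _))) p)
  near-mulˡ (near₂ p) (mul₂ m) = _ , mul₂ H₂.refl ,
    near₂ (ℝ.≤.≲-respˡ-≈ (ℝ.sym (ℝ.trans (H₂.d-cong H₂.refl m) (H₂.invariantˡ _ _ _))) p)

  near-mulʳ : ∀ {c x x′ y z} → Near c x′ x → Mul x y z →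
              ∃[ z′ ] Mul x′ y z′ × Near c z′ z
  near-mulʳ (near₁ p) (mul₁ m) = _ , mul₁ H₁.refl ,
    near₁ (ℝ.≤.≲-respˡ-≈ (ℝ.sym (ℝ.trans (H₁.d-cong H₁.refl m) (H₁.invariantʳ _ _ _))) p)
  near-mulʳ (near₂ p) (mul₂ m) = _ , mul₂ H₂.refl ,
    near₂ (ℝ.≤.≲-respˡ-≈ (ℝ.sym (ℝ.trans (H₂.d-cong H₂.refl m) (H₂.invariantʳ _ _ _))) p)

  mul-nearʳ : ∀ {x y z} → Mul x y z → Near (norm x) z y
  mul-nearʳ (mul₁ m) = near₁ (ℝ.≤.reflexive (ℝ.trans (H₁.d-cong m H₁.refl) (M₁.d-∙ʳ _ _)))
  mul-nearʳ (mul₂ m) = near₂ (ℝ.≤.reflexive (ℝ.trans (H₂.d-cong m H₂.refl) (M₂.d-∙ʳ _ _)))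

  mul-nearˡ : ∀ {x y z} → Mul x y z → Near (norm y) z x
  mul-nearˡ (mul₁ m) = near₁ (ℝ.≤.reflexive (ℝ.trans (H₁.d-cong m H₁.refl) (M₁.d-∙ˡ _ _)))
  mul-nearˡ (mul₂ m) = near₂ (ℝ.≤.reflexive (ℝ.trans (H₂.d-cong m H₂.refl) (M₂.d-∙ˡ _ _)))

  mul-unique : ∀ {x y z z′} → Mul x y z → Mul x y z′ → Near ℝ.0# z z′
  mul-unique (mul₁ p) (mul₁ q) =
    near₁ (ℝ.≤.reflexive (H₁.≈⇒d≈0 (H₁.trans p (H₁.sym q))))
  mul-unique (mul₂ p) (mul₂ q) =
    near₂ (ℝ.≤.reflexive (H₂.≈⇒d≈0 (H₂.trans p (H₂.sym q))))

  mul-assocʳ : ∀ {x y z xy yz} → Mul x y xy → Mul y z yz →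
               ∃[ xyz ] Mul xy z xyz × Mul x yz xyz
  mul-assocʳ (mul₁ p) (mul₁ q) = _ , mul₁ (H₁.∙-congʳ (H₁.sym p)) ,
    mul₁ (H₁.trans (H₁.assoc _ _ _) (H₁.∙-congˡ (H₁.sym q)))
  mul-assocʳ (mul₂ p) (mul₂ q) = _ , mul₂ (H₂.∙-congʳ (H₂.sym p)) ,
    mul₂ (H₂.trans (H₂.assoc _ _ _) (H₂.∙-congˡ (H₂.sym q)))

  data Step : Word → Word → ℝ.Carrier → Set u where
    merge  : ∀ {x y z w} → Mul x y z → Step (x ∷ y ∷ w) (z ∷ w) ℝ.0#
    delete : ∀ {x w} → Step (x ∷ w) w (norm x)
    skip   : ∀ {x v w c} → Step v w c → Step (x ∷ v) (x ∷ w) c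

  data Collapses : Word → ℝ.Carrier → Set u where
    done : ∀ {c} → ℝ.0# ℝ.≤ c → Collapses [] c
    step : ∀ {v w a b c} → Step v w a → Collapses w b → a ℝ.+ b ℝ.≤ c → Collapses v c

  collapses-weaken : ∀ {w b c} → b ℝ.≤ c → Collapses w b → Collapses w c
  collapses-weaken le (done p)     = done (ℝ.≤.trans p le)
  collapses-weaken le (step s p q) = step s p (ℝ.≤.trans q le)

  -- Defect b v w bounds by b the price by which v can be harder to destroy than w.
  data Defect (b : ℝ.Carrier) : Word → Word → Set u where
    same   : ∀ {w} → ℝ.0# ℝ.≤ b → Defect b w w
    change : ∀ {x y w} → Near b x y → Defect b (x ∷ w) (y ∷ w)
    drop   : ∀ {x w} → norm x ℝ.≤ b → Defect b w (x ∷ w)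
    fuse   : ∀ {x y z w} → ℝ.0# ℝ.≤ b → Mul x y z → Defect b (z ∷ w) (x ∷ y ∷ w)
    there  : ∀ {x v w} → Defect b v w → Defect b (x ∷ v) (x ∷ w)

  defect-++ˡ : ∀ u {b v w} → Defect b v w → Defect b (u ++ v) (u ++ w)
  defect-++ˡ []      p = p
  defect-++ˡ (x ∷ u) p = there (defect-++ˡ u p)

  data Step⁼ : Word → Word → ℝ.Carrier → Set u where
    stay : ∀ {w} → Step⁼ w w ℝ.0#
    move : ∀ {v w c} → Step v w c → Step⁼ v w c

  Simulated : Word → Word → ℝ.Carrier → Set u
  Simulated v w c = ∃[ v′ ] ∃[ a ] ∃[ b ] Step⁼ v v′ a × Defect b v′ w × a ℝ.+ b ℝ.≤ c

  private
    commutes : ∀ {a b} → a ℝ.+ b ℝ.≤ b ℝ.+ a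
    commutes = ℝ.≤.reflexive (ℝ.+-comm _ _)

    skip⁼ : ∀ {x v w c} → Step⁼ v w c → Step⁼ (x ∷ v) (x ∷ w) c
    skip⁼ stay     = stay
    skip⁼ (move s) = move (skip s)

  -- The step is repeated on `v`, unless it acts where the words differ and `v` can stand still.
  -- What is left of the difference is again a single defect, bounded by two-sided invariance.
  simulate : ∀ {b c v w w′} → Defect b v w → Step w w′ c → Simulated v w′ (b ℝ.+ c)
  simulate (same p)   s = _ , _ , _ , move s , same p , commutes
  simulate (change n) (merge m) =
    let _ , m′ , n′ = near-mulʳ n m in _ , _ , _ , move (merge m′) , change n′ , commutes
  simulate (change n) delete =
    _ , _ , _ , move delete , same ℝ.≤.refl , ℝ.≤.trans x+0≤x (near-norm n)
  simulate (change n) (skip s) = _ , _ , _ , move (skip s) , change n , commutes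
  -- The product differs from the letter kept in `v` by the norm of the dropped letter.
  simulate (drop p) (merge m) =
    _ , _ , _ , stay , change (near-weaken p (near-sym (mul-nearʳ m))) , commutes
  simulate (drop {x} p) delete =
    _ , _ , _ , stay , same ℝ.≤.refl ,
    ℝ.≤.trans 0+x≤x (ℝ.+-nonNeg (ℝ.≤.trans (norm-nonNeg x) p) (norm-nonNeg x))
  simulate (drop p) (skip s) = _ , _ , _ , move s , drop p , commutes
  simulate (fuse p m) (merge m′) =
    _ , _ , _ , stay , change (mul-unique m m′) , ℝ.+-monoˡ-≤ _ p
  -- `v` already holds the product, which lies within `norm x` of the surviving factor: the price of
  -- the deletion becomes the defect.
  simulate (fuse p m) delete =
    _ , _ , _ , stay , change (mul-nearʳ m) , ℝ.+-monoˡ-≤ _ p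
  simulate (fuse p m) (skip delete) =
    _ , _ , _ , stay , change (mul-nearˡ m) , ℝ.+-monoˡ-≤ _ p
  simulate (fuse p m) (skip (merge m′)) =
    let _ , n , n′ = mul-assocʳ m m′ in _ , _ , _ , move (merge n) , fuse p n′ , commutes
  simulate (fuse p m) (skip (skip s)) = _ , _ , _ , move (skip s) , fuse p m , commutes
  simulate (there D) delete = _ , _ , _ , move delete , D , commutes
  simulate (there D) (skip s) =
    let _ , _ , _ , s′ , D′ , le = simulate D s in _ , _ , _ , skip⁼ s′ , there D′ , le
  simulate (there (same p)) (merge m) = _ , _ , _ , move (merge m) , same p , commutes
  simulate (there (change n)) (merge m) =
    let _ , m′ , n′ = near-mulˡ n m in _ , _ , _ , move (merge m′) , change n′ , commutes
  simulate (there (drop p)) (merge m) =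
    _ , _ , _ , stay , change (near-weaken p (near-sym (mul-nearˡ m))) , commutes
  simulate (there (fuse p m′)) (merge m) =
    let _ , n , n′ = mul-assocʳ m m′ in _ , _ , _ , move (merge n′) , fuse p n , commutes
  simulate (there (there D)) (merge m) =
    _ , _ , _ , move (merge m) , there D , commutes

  -- Induction on the strategy for `w`, carrying the defect along; in the case `stay` the word `v`
  -- waits while the strategy advances. Once `w` is empty, only `same` is possible.
  collapses-defect : ∀ {b c v w} → Defect b v w → Collapses w c → Collapses v (b ℝ.+ c)
  collapses-defect (same p) q = collapses-weaken (x≤y+x p) q
  collapses-defect {b} {c} D (step {a = s} {b = c′} S q le)
    with _ , a , b′ , S′ , D′ , le′ ← simulate D S = go S′
    where
    open ≤-Reasoning
    bound : a ℝ.+ (b′ ℝ.+ c′) ℝ.≤ b ℝ.+ c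
    bound = begin
      a ℝ.+ (b′ ℝ.+ c′)   ≈⟨ ℝ.+-assoc a b′ c′ ⟨
      (a ℝ.+ b′) ℝ.+ c′   ≤⟨ ℝ.+-monoˡ-≤ c′ le′ ⟩
      (b ℝ.+ s) ℝ.+ c′    ≈⟨ ℝ.+-assoc b s c′ ⟩
      b ℝ.+ (s ℝ.+ c′)    ≤⟨ ℝ.+-monoʳ-≤ b le ⟩
      b ℝ.+ c             ∎
    go : Step⁼ _ _ a → Collapses _ (b ℝ.+ c)
    go stay     = collapses-weaken (ℝ.≤.≲-respˡ-≈ (ℝ.+-identityˡ _) bound)
                    (collapses-defect D′ q)
    go (move s) = step s (collapses-defect D′ q) bound

  step-++ˡ : ∀ u {v w c} → Step v w c → Step (u ++ v) (u ++ w) c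
  step-++ˡ []      s = s
  step-++ˡ (x ∷ u) s = skip (step-++ˡ u s)

  step-++ʳ : ∀ u {v w c} → Step v w c → Step (v ++ u) (w ++ u) c
  step-++ʳ u (merge m) = merge m
  step-++ʳ u delete    = delete
  step-++ʳ u (skip s)  = skip (step-++ʳ u s)

  collapses-insert : ∀ u {w v b c} → Collapses w b → Collapses (u ++ v) c →
                     Collapses (u ++ w ++ v) (b ℝ.+ c)
  collapses-insert u (done p) q = collapses-weaken (x≤y+x p) q
  collapses-insert u {v = v} (step s p le) q =
    step (step-++ˡ u (step-++ʳ v s)) (collapses-insert u p q)
      (ℝ.≤.≲-respˡ-≈ (ℝ.+-assoc _ _ _) (ℝ.+-monoˡ-≤ _ le))

  -- Invariance of the price under the congruence.

  private
    -- Quantifying over contexts makes the relation compatible with concatenation, as the case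
    -- `++-cong` requires.
    _⊑_ : Word → Word → Set u
    v ⊑ w = ∀ l r {c} → Collapses (l ++ v ++ r) c → Collapses (l ++ w ++ r) c

    free : ∀ {l v w c} → Defect ℝ.0# v w → Collapses (l ++ w) c → Collapses (l ++ v) c
    free {l} D p = collapses-weaken 0+x≤x (collapses-defect (defect-++ˡ l D) p)

    pay : ∀ {l v w b c} → b ℝ.≈ ℝ.0# → Step v w b → Collapses (l ++ w) c →
          Collapses (l ++ v) c
    pay {l} eq s p =
      step (step-++ˡ l s) p (ℝ.≤.reflexive (ℝ.trans (ℝ.+-congʳ eq) (ℝ.+-identityˡ _)))

    ⊑-++ : ∀ {v v′ w w′} → v ⊑ v′ → w ⊑ w′ → (v ++ w) ⊑ (v′ ++ w′)
    ⊑-++ {v} {v′} {w} {w′} p q l r {c} C =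
      ≡.subst (λ x → Collapses x c)
        (≡.trans (List.++-assoc l v′ (w′ ++ r))
          (≡.cong (l ++_) (≡.sym (List.++-assoc v′ w′ r))))
        (q (l ++ v′) r
          (≡.subst (λ x → Collapses x c) (≡.sym (List.++-assoc l v′ (w ++ r)))
            (p l (w ++ r)
              (≡.subst (λ x → Collapses x c) (≡.cong (l ++_) (List.++-assoc v w r)) C))))

    near₁-0 : ∀ {x y} → x H₁.≈ y → Near ℝ.0# (inj₁ x) (inj₁ y)
    near₁-0 p = near₁ (ℝ.≤.reflexive (H₁.≈⇒d≈0 p))

    near₂-0 : ∀ {x y} → x H₂.≈ y → Near ℝ.0# (inj₂ x) (inj₂ y)
    near₂-0 p = near₂ (ℝ.≤.reflexive (H₂.≈⇒d≈0 p))

    -- Both directions are proved together because `sym` exchanges them. A generating relation is a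
    -- defect of price 0 in one direction; in the other it is again such a defect for `cong₁` and
    -- `cong₂`, and a step of price 0 for products and units.
    ≋⇒⊑⊒ : ∀ {v w} → v ≋ w → v ⊑ w × w ⊑ v
    ≋⇒⊑⊒ refl          = (λ _ _ p → p) , (λ _ _ p → p)
    ≋⇒⊑⊒ (sym p)       = swap (≋⇒⊑⊒ p)
    ≋⇒⊑⊒ (trans p q)   =
      (λ l r C → proj₁ (≋⇒⊑⊒ q) l r (proj₁ (≋⇒⊑⊒ p) l r C)) ,
      (λ l r C → proj₂ (≋⇒⊑⊒ p) l r (proj₂ (≋⇒⊑⊒ q) l r C))
    ≋⇒⊑⊒ (++-cong {v} {v′} {w} {w′} p q) =
      ⊑-++ {v} {v′} {w} {w′} (proj₁ (≋⇒⊑⊒ p)) (proj₁ (≋⇒⊑⊒ q)) ,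
      ⊑-++ {v′} {v} {w′} {w} (proj₂ (≋⇒⊑⊒ p)) (proj₂ (≋⇒⊑⊒ q))
    ≋⇒⊑⊒ (cong₁ p)     =
      (λ l _ → free {l} (change (near₁-0 (H₁.sym p)))) , (λ l _ → free {l} (change (near₁-0 p)))
    ≋⇒⊑⊒ (cong₂ p)     =
      (λ l _ → free {l} (change (near₂-0 (H₂.sym p)))) , (λ l _ → free {l} (change (near₂-0 p)))
    ≋⇒⊑⊒ (mult₁ x y)   =
      (λ l _ → free {l} (fuse ℝ.≤.refl (mul₁ H₁.refl))) ,
      (λ l _ → pay {l} ℝ.refl (merge (mul₁ H₁.refl)))
    ≋⇒⊑⊒ (mult₂ x y)   =
      (λ l _ → free {l} (fuse ℝ.≤.refl (mul₂ H₂.refl))) ,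
      (λ l _ → pay {l} ℝ.refl (merge (mul₂ H₂.refl)))
    ≋⇒⊑⊒ unit₁         =
      (λ l _ → free {l} (drop (ℝ.≤.reflexive M₁.d-refl))) , (λ l _ → pay {l} M₁.d-refl delete)
    ≋⇒⊑⊒ unit₂         =
      (λ l _ → free {l} (drop (ℝ.≤.reflexive M₂.d-refl))) , (λ l _ → pay {l} M₂.d-refl delete)

  collapses-resp : ∀ {v w c} → v ≋ w → Collapses v c → Collapses w c
  collapses-resp {v} {w} {c} p C =
    ≡.subst (λ x → Collapses x c) (List.++-identityʳ w)
      (proj₁ (≋⇒⊑⊒ p) [] [] (≡.subst (λ x → Collapses x c) (≡.sym (List.++-identityʳ v)) C))

  private
    both : ∀ x y {c} → norm x ℝ.+ norm (invLetter y) ℝ.≤ c →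
           Collapses (x ∷ invLetter y ∷ []) c
    both x y le = step delete (step delete (done ℝ.≤.refl) x+0≤x) le

    pair : ∀ x y → Collapses (x ∷ invLetter y ∷ []) (d-letter x y)
    pair (inj₁ x) (inj₁ y) = step (merge (mul₁ H₁.refl))
      (step delete (done ℝ.≤.refl) (ℝ.≤.trans x+0≤x (ℝ.≤.reflexive (M₁.∥x∙y⁻¹∥ x y)))) 0+x≤x
    pair (inj₂ x) (inj₂ y) = step (merge (mul₂ H₂.refl))
      (step delete (done ℝ.≤.refl) (ℝ.≤.trans x+0≤x (ℝ.≤.reflexive (M₂.∥x∙y⁻¹∥ x y)))) 0+x≤x
    pair (inj₁ x) (inj₂ y) =
      both (inj₁ x) (inj₂ y) (ℝ.≤.reflexive (ℝ.+-congˡ (M₂.∥x⁻¹∥ y)))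
    pair (inj₂ x) (inj₁ y) =
      both (inj₂ x) (inj₁ y) (ℝ.≤.reflexive (ℝ.+-congˡ (M₁.∥x⁻¹∥ y)))

    -- Inversion reverses `β`, so corresponding letters are nested around the middle. The word is
    -- destroyed from the inside outwards, each pair `x`, `invLetter y` at the price `d-letter x y`.
    zip : ∀ {n} (α β : Vec Letter n) →
          Collapses (product α ++ inv (product β)) (cost α β)
    zip []      []      = done ℝ.≤.refl
    zip (x ∷ α) (y ∷ β) =
      ≡.subst (λ w → Collapses (x ∷ w) (d-letter x y ℝ.+ cost α β))
        (List.++-assoc (product α) (inv (product β)) (invLetter y ∷ []))
        (collapses-weaken (ℝ.≤.reflexive (ℝ.+-comm _ _))
          (collapses-insert (x ∷ []) (zip α β) (pair x y)))

  costs⇒collapses : ∀ {f g r} → costs f g r → Collapses (f ++ inv g) r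
  costs⇒collapses (_ , α , β , p , q , eq) =
    collapses-weaken (ℝ.≤.reflexive (ℝ.sym eq))
      (collapses-resp (++-cong p (F.⁻¹-cong q)) (zip α β))

-- Expansions of words over `G` and a conjugated copy.

-- An isometric copy of a group B of diameter at most 1 inside G is conjugated
-- by t; words over G and B are expanded accordingly into words over G and t.
module Expansion {u} {ℝ : CompleteOrderedField u} (G B : MetricGroup ℝ)
  (ψ : MetricGroup.Carrier B → MetricGroup.Carrier G)
  (ψ-∙ : ∀ x y → MetricGroup._≈_ G (ψ (MetricGroup._∙_ B x y)) (MetricGroup._∙_ G (ψ x) (ψ y)))
  (ψ-ε : MetricGroup._≈_ G (ψ (MetricGroup.ε B)) (MetricGroup.ε G))
  (ψ-isometry : ∀ x y →
    CompleteOrderedField._≈_ ℝ (MetricGroup.d B x y) (MetricGroup.d G (ψ x) (ψ y))) where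

  private
    module ℝ = CompleteOrderedField ℝ
    module G = MetricGroup G
    module B = MetricGroup B
    ⟨t⟩-metric = ⟨t⟩-metricGroup ℝ
    module T = MetricGroup ⟨t⟩-metric
    module G*B = FreeProduct G.group B.group
    module K = FreeProduct G.group T.group
    module MG = Metric G
    module MB = Metric B
    module GB = Graev G B
    module KD = Distance G ⟨t⟩-metric
    module C = Collapse G ⟨t⟩-metric
  open Distance G B
  open Real ℝ

  t t⁻¹ : K.Letter
  t   = inj₂ (t^ ℤ.1ℤ)
  t⁻¹ = inj₂ (t^ (ℤ.- ℤ.1ℤ))

  expandLetter : G*B.Letter → K.Word
  expandLetter (inj₁ g) = inj₁ g ∷ []
  expandLetter (inj₂ b) = t ∷ inj₁ (ψ b) ∷ t⁻¹ ∷ []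

  expand : G*B.Word → K.Word
  expand []      = []
  expand (x ∷ w) = expandLetter x ++ expand w

  ψ-cong : ∀ {x y} → x B.≈ y → ψ x G.≈ ψ y
  ψ-cong p = G.d≈0⇒≈ (ℝ.trans (ℝ.sym (ψ-isometry _ _)) (B.≈⇒d≈0 p))

  ψ-injective : ∀ {x y} → ψ x G.≈ ψ y → x B.≈ y
  ψ-injective p = B.d≈0⇒≈ (ℝ.trans (ψ-isometry _ _) (G.≈⇒d≈0 p))

  ∥ψ∥ : ∀ b → MG.∥ ψ b ∥ ℝ.≈ MB.∥ b ∥
  ∥ψ∥ b = ℝ.trans (G.d-cong G.refl (G.sym ψ-ε)) (ℝ.sym (ψ-isometry b B.ε))

  private
    conj-cong : ∀ {x y c} → G.d x y ℝ.≤ c →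
                KD.Within (t ∷ inj₁ x ∷ t⁻¹ ∷ []) (t ∷ inj₁ y ∷ t⁻¹ ∷ []) c
    conj-cong {x} {y} p = KD.within-++ˡ (t ∷ []) (KD.within-++ʳ (t⁻¹ ∷ [])
      (KD.within-letter (inj₁ x) (inj₁ y) p))

    conj-ε : ∀ {x} → x G.≈ G.ε → t ∷ inj₁ x ∷ t⁻¹ ∷ [] K.≋ []
    conj-ε p = K.trans
      (K.++-cong (K.refl {t ∷ []})
        (K.++-cong (K.trans (K.cong₁ p) K.unit₁) (K.refl {t⁻¹ ∷ []})))
      (K.trans (K.mult₂ _ _) K.unit₂)

  within-expandLetter : ∀ x y → KD.Within (expandLetter x) (expandLetter y) (GB.d-letter x y)
  within-expandLetter (inj₁ x) (inj₁ y) = KD.within-letter (inj₁ x) (inj₁ y) ℝ.≤.refl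
  within-expandLetter (inj₂ x) (inj₂ y) = conj-cong (ℝ.≤.reflexive (ℝ.sym (ψ-isometry x y)))
  -- The path leads through the empty word, which equals both the unit letter of `G` and
  -- `t ψ(ε) t⁻¹`.
  within-expandLetter (inj₁ x) (inj₂ y) = KD.within-trans
    (KD.within-resp K.refl K.unit₁ (KD.within-letter (inj₁ x) (inj₁ G.ε) ℝ.≤.refl))
    (KD.within-resp (conj-ε ψ-ε) K.refl (conj-cong (ℝ.≤.reflexive (ℝ.sym (ψ-isometry B.ε y)))))
  within-expandLetter (inj₂ x) (inj₁ y) = KD.within-trans
    (KD.within-resp K.refl (conj-ε ψ-ε) (conj-cong (ℝ.≤.reflexive (ℝ.sym (ψ-isometry x B.ε)))))
    (KD.within-resp K.unit₁ K.refl (KD.within-letter (inj₁ G.ε) (inj₁ y) ℝ.≤.refl))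

  -- Expanding letter by letter raises no cost; this is what `d|≤d̲` rests on.
  within-expand : ∀ {n} (α β : Vec G*B.Letter n) →
    KD.Within (expand (GB.product α)) (expand (GB.product β)) (GB.cost α β)
  within-expand []      []      = KD.within-[] ℝ.≤.refl
  within-expand (x ∷ α) (y ∷ β) =
    KD.within-++ (within-expandLetter x y) (within-expand α β)

  -- Stretches of an expansion and their values.

  module _ (bounded : ∀ b → MB.∥ b ∥ ℝ.≤ ℝ.1#) where

    -- A prefix of an expansion has height hi if it ends inside some t b t⁻¹ and
    -- height lo otherwise.
    data Height : Set where
      lo hi : Height

    flip : Height → Height
    flip lo = hi
    flip hi = lo

    weight : Height → ℝ.Carrier
    weight lo = ℝ.0#
    weight hi = ℝ.1#

    -- A tag is the part of some `t b t⁻¹` left over on one side of a deleted `t` or `t⁻¹`. At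
    -- height `lo` nothing has been cut and the tag is trivial; stating this as a condition lets one
    -- constructor `outer` serve all four pairs of heights.
    Tag : Height → B.Carrier → Set u
    Tag lo b = b B.≈ B.ε
    Tag hi b = ⊤

    tag-ε : ∀ i → Tag i B.ε
    tag-ε lo = B.refl
    tag-ε hi = tt

    tagged : B.Carrier → G.Carrier → B.Carrier → G*B.Word
    tagged a g b = inj₂ a ∷ inj₁ g ∷ inj₂ b ∷ []

    -- Segment i j h y c: the stretch of an expansion from height i to height j
    -- which comes from h becomes y once its letters t and t⁻¹ are deleted, and
    -- c is the price paid so far. In the case outer, an end at height hi lies
    -- inside some t b t⁻¹ of which the stretch has lost the letter t or t⁻¹; the
    -- price of that letter is the slack weight hi.
    data Segment : Height → Height → G*B.Word → G.Carrier → ℝ.Carrier → Set u where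
      inner : ∀ {h y c} b → y G.≈ ψ b → Within h (G*B.ι₂ b) c → Segment hi hi h y c
      outer : ∀ {i j h y c r} a g b → Tag i a → Tag j b → y G.≈ ψ a G.∙ g G.∙ ψ b →
              Within h (tagged a g b) r → r ℝ.+ (weight i ℝ.+ weight j) ℝ.≤ c →
              Segment i j h y c

    segment-weaken : ∀ {i j h y b c} → b ℝ.≤ c → Segment i j h y b → Segment i j h y c
    segment-weaken le (inner b eq w)           = inner b eq (within-weaken le w)
    segment-weaken le (outer a g b p q eq w l) = outer a g b p q eq w (ℝ.≤.trans l le)

    segment-respʷ : ∀ {i j h h′ y c} → h G*B.≋ h′ → Segment i j h y c → Segment i j h′ y c
    segment-respʷ p (inner b eq w)            =
      inner b eq (within-resp p G*B.refl w)
    segment-respʷ p (outer a g b q q′ eq w l) =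
      outer a g b q q′ eq (within-resp p G*B.refl w) l

    segment-respᵍ : ∀ {i j h y y′ c} → y G.≈ y′ → Segment i j h y c → Segment i j h y′ c
    segment-respᵍ p (inner b eq w)            = inner b (G.trans (G.sym p) eq) w
    segment-respᵍ p (outer a g b q q′ eq w l) = outer a g b q q′ (G.trans (G.sym p) eq) w l

    private
      ι₂-cong-ε : ∀ {b} → b B.≈ B.ε → G*B.ι₂ b G*B.≋ []
      ι₂-cong-ε p = G*B.trans (G*B.cong₂ p) G*B.unit₂

      ι₁-cong-ε : ∀ {g} → g G.≈ G.ε → G*B.ι₁ g G*B.≋ []
      ι₁-cong-ε p = G*B.trans (G*B.cong₁ p) G*B.unit₁

      tagged-trivial : ∀ {a g b} → a B.≈ B.ε → g G.≈ G.ε → b B.≈ B.ε →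
                       tagged a g b G*B.≋ []
      tagged-trivial p q r =
        G*B.++-cong (ι₂-cong-ε p) (G*B.++-cong (ι₁-cong-ε q) (ι₂-cong-ε r))

      ψ-ε′ : ∀ {b} → b B.≈ B.ε → ψ b G.≈ G.ε
      ψ-ε′ p = G.trans (ψ-cong p) ψ-ε

      ε-sandwich : ∀ {x y} → x G.≈ G.ε → y G.≈ G.ε → ∀ g → g G.≈ x G.∙ g G.∙ y
      ε-sandwich p q g = G.sym (G.trans (G.∙-cong (G.trans (G.∙-congʳ p) (G.identityˡ g)) q)
                                        (G.identityʳ g))

    -- At height `hi` the tags multiply to one letter of `B`, which is moved through the unit to its
    -- copy in `G`. Both norms are at most 1, and the two weights stand for the deleted letters that
    -- enclose it.
    lower-tags : ∀ j {b a} → Tag j b → Tag j a →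
                 Within (G*B.ι₂ b ++ G*B.ι₂ a) (G*B.ι₁ (ψ (b B.∙ a))) (weight j ℝ.+ weight j)
    lower-tags lo p q = within-weaken (ℝ.≤.reflexive (ℝ.sym (ℝ.+-identityˡ _)))
      (within-≋ (G*B.trans (G*B.++-cong (ι₂-cong-ε p) (ι₂-cong-ε q))
        (G*B.sym (ι₁-cong-ε (ψ-ε′ (B.trans (B.∙-cong p q) (B.identityˡ _)))))))
    lower-tags hi {b} {a} _ _ = within-resp (G*B.sym (G*B.mult₂ b a)) G*B.refl
      (within-letter (inj₂ (b B.∙ a)) (inj₁ (ψ (b B.∙ a))) (+-mono-≤ (bounded _)
        (ℝ.≤.trans (ℝ.≤.reflexive (ℝ.trans (G.symmetric _ _) (∥ψ∥ _))) (bounded _))))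

    private
      -- The adjacent stretches both hold the weight `y` of their common end; `y + y` is released to
      -- pay for `lower-tags`.
      regroup : ∀ {r s x y z c c′} → r ℝ.+ (x ℝ.+ y) ℝ.≤ c → s ℝ.+ (y ℝ.+ z) ℝ.≤ c′ →
                (r ℝ.+ ((y ℝ.+ y) ℝ.+ s)) ℝ.+ (x ℝ.+ z) ℝ.≤ c ℝ.+ c′
      regroup {r} {s} {x} {y} {z} {c} {c′} p q = begin
        (r ℝ.+ ((y ℝ.+ y) ℝ.+ s)) ℝ.+ (x ℝ.+ z)   ≈⟨ ℝ.+-congʳ (ℝ.+-congˡ (ℝ.+-comm _ s)) ⟩
        (r ℝ.+ (s ℝ.+ (y ℝ.+ y))) ℝ.+ (x ℝ.+ z)   ≈⟨ ℝ.+-congʳ (ℝ.+-assoc r s _) ⟨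
        ((r ℝ.+ s) ℝ.+ (y ℝ.+ y)) ℝ.+ (x ℝ.+ z)   ≈⟨ ℝ.+-assoc (r ℝ.+ s) _ _ ⟩
        (r ℝ.+ s) ℝ.+ ((y ℝ.+ y) ℝ.+ (x ℝ.+ z))   ≈⟨ ℝ.+-congˡ (interchange y y x z) ⟩
        (r ℝ.+ s) ℝ.+ ((y ℝ.+ x) ℝ.+ (y ℝ.+ z))   ≈⟨ ℝ.+-congˡ (ℝ.+-congʳ (ℝ.+-comm y x)) ⟩
        (r ℝ.+ s) ℝ.+ ((x ℝ.+ y) ℝ.+ (y ℝ.+ z))   ≈⟨ interchange r s _ _ ⟩
        (r ℝ.+ (x ℝ.+ y)) ℝ.+ (s ℝ.+ (y ℝ.+ z))   ≤⟨ +-mono-≤ p q ⟩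
        c ℝ.+ c′                                  ∎
        where open ≤-Reasoning

      slide : ∀ {r w c c′} → r ℝ.+ w ℝ.≤ c → (r ℝ.+ c′) ℝ.+ w ℝ.≤ c ℝ.+ c′
      slide {r} {w} {c} {c′} p = begin
        (r ℝ.+ c′) ℝ.+ w   ≈⟨ ℝ.+-assoc r c′ w ⟩
        r ℝ.+ (c′ ℝ.+ w)   ≈⟨ ℝ.+-congˡ (ℝ.+-comm c′ w) ⟩
        r ℝ.+ (w ℝ.+ c′)   ≈⟨ ℝ.+-assoc r w c′ ⟨
        (r ℝ.+ w) ℝ.+ c′   ≤⟨ ℝ.+-monoˡ-≤ c′ p ⟩
        c ℝ.+ c′           ∎
        where open ≤-Reasoning

    -- Inner stretches multiply inside `B`, and the tag of an outer stretch absorbs an inner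
    -- neighbour. Between two outer stretches the tags `b` and `a′` meet; `lower-tags` turns them
    -- into a letter of `G`, which merges with `g` and `g′`.
    join : ∀ {i j k h h′ x y c c′} → Segment i j h x c → Segment j k h′ y c′ →
           Segment i k (h ++ h′) (x G.∙ y) (c ℝ.+ c′)
    join (inner b eq w) (inner b′ eq′ w′) =
      inner (b B.∙ b′) (G.trans (G.∙-cong eq eq′) (G.sym (ψ-∙ b b′)))
        (within-resp G*B.refl (G*B.mult₂ b b′) (within-++ w w′))
    join (inner b eq w) (outer a g b′ _ q eq′ w′ le) =
      outer (b B.∙ a) g b′ tt q
        (G.trans (G.∙-cong eq eq′)
          (G.trans (G.sym (G.assoc _ _ _)) (G.∙-congʳ
            (G.trans (G.sym (G.assoc _ _ _)) (G.∙-congʳ (G.sym (ψ-∙ b a)))))))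
        (within-resp G*B.refl (G*B.++-cong (G*B.mult₂ b a) G*B.refl) (within-++ w w′))
        (ℝ.≤.≲-respʳ-≈ (ℝ.+-comm _ _) (ℝ.≤.≲-respˡ-≈ (ℝ.+-congʳ (ℝ.+-comm _ _)) (slide le)))
    join (outer a g b p _ eq w le) (inner b′ eq′ w′) =
      outer a g (b B.∙ b′) p tt
        (G.trans (G.∙-cong eq eq′)
          (G.trans (G.assoc _ _ _) (G.∙-congˡ (G.sym (ψ-∙ b b′)))))
        (within-resp G*B.refl
          (G*B.++-cong (G*B.refl {inj₂ a ∷ inj₁ g ∷ []}) (G*B.mult₂ b b′)) (within-++ w w′))
        (slide le)
    join {j = j} (outer a g b p q eq w le) (outer a′ g′ b′ p′ q′ eq′ w′ le′) =
      outer a (g G.∙ ψ (b B.∙ a′) G.∙ g′) b′ p q′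
        (G.trans (G.∙-cong eq eq′) rearrange)
        (within-trans (within-++ w w′)
          (within-resp G*B.refl contract
            (within-++ˡ (inj₂ a ∷ inj₁ g ∷ []) (within-++ʳ (inj₁ g′ ∷ inj₂ b′ ∷ [])
              (lower-tags j q p′)))))
        (ℝ.≤.≲-respˡ-≈ (ℝ.+-congʳ (ℝ.trans (ℝ.+-congˡ (ℝ.+-comm _ _)) (ℝ.sym (ℝ.+-assoc _ _ _))))
          (regroup le le′))
      where
      contract : (inj₂ a ∷ inj₁ g ∷ []) ++ G*B.ι₁ (ψ (b B.∙ a′)) ++ inj₁ g′ ∷ inj₂ b′ ∷ []
                 G*B.≋ tagged a (g G.∙ ψ (b B.∙ a′) G.∙ g′) b′
      contract = G*B.++-cong (G*B.refl {G*B.ι₂ a})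
        (G*B.++-cong
          (G*B.trans (G*B.++-cong (G*B.mult₁ g (ψ (b B.∙ a′))) (G*B.refl {G*B.ι₁ g′}))
            (G*B.mult₁ _ g′))
          (G*B.refl {G*B.ι₂ b′}))
      open import Relation.Binary.Reasoning.Setoid G.setoid
      rearrange : (ψ a G.∙ g G.∙ ψ b) G.∙ (ψ a′ G.∙ g′ G.∙ ψ b′)
                  G.≈ ψ a G.∙ (g G.∙ ψ (b B.∙ a′) G.∙ g′) G.∙ ψ b′
      rearrange = begin
        (ψ a G.∙ g G.∙ ψ b) G.∙ (ψ a′ G.∙ g′ G.∙ ψ b′)     ≈⟨ G.assoc _ _ _ ⟨
        (ψ a G.∙ g G.∙ ψ b) G.∙ (ψ a′ G.∙ g′) G.∙ ψ b′     ≈⟨ G.∙-congʳ (G.assoc _ _ _) ⟨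
        (ψ a G.∙ g G.∙ ψ b) G.∙ ψ a′ G.∙ g′ G.∙ ψ b′       ≈⟨ G.∙-congʳ (G.∙-congʳ (G.assoc _ _ _)) ⟩
        (ψ a G.∙ g) G.∙ (ψ b G.∙ ψ a′) G.∙ g′ G.∙ ψ b′     ≈⟨ G.∙-congʳ (G.∙-congʳ (G.∙-congˡ (ψ-∙ b a′))) ⟨
        (ψ a G.∙ g) G.∙ ψ (b B.∙ a′) G.∙ g′ G.∙ ψ b′       ≈⟨ G.∙-congʳ (G.∙-congʳ (G.assoc _ _ _)) ⟩
        ψ a G.∙ (g G.∙ ψ (b B.∙ a′)) G.∙ g′ G.∙ ψ b′       ≈⟨ G.∙-congʳ (G.assoc _ _ _) ⟩
        ψ a G.∙ (g G.∙ ψ (b B.∙ a′) G.∙ g′) G.∙ ψ b′       ∎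

    -- In the first two cases all remaining letters are units. In the last one, triviality of the
    -- value gives `g` the norm of `a ∙ b`; deleting `g` and then `a ∙ b` costs at most 1 each,
    -- which the weights of the two ends cover.
    close : ∀ i {h c} → Segment i i h G.ε c → Within h [] c
    close hi (inner b eq w) =
      within-resp G*B.refl (ι₂-cong-ε (ψ-injective (G.trans (G.sym eq) (G.sym ψ-ε)))) w
    close lo (outer a g b p q eq w le) =
      within-weaken (ℝ.≤.trans (ℝ.≤.reflexive (ℝ.sym (ℝ.trans (ℝ.+-congˡ (ℝ.+-identityˡ _)) (ℝ.+-identityʳ _)))) le)
        (within-resp G*B.refl
          (tagged-trivial p (G.trans (ε-sandwich (ψ-ε′ p) (ψ-ε′ q) g) (G.sym eq)) q) w)
    close hi (outer a g b _ _ eq w le) =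
      within-weaken le (within-trans w (within-trans
        (within-resp G*B.refl contract
          (within-++ˡ (G*B.ι₂ a) (within-++ʳ (G*B.ι₂ b)
            (within-letter (inj₁ g) (inj₁ G.ε) ∥g∥≤1))))
        (within-resp G*B.refl G*B.unit₂ (within-letter (inj₂ (a B.∙ b)) (inj₂ B.ε) (bounded _)))))
      where
      contract : tagged a G.ε b G*B.≋ G*B.ι₂ (a B.∙ b)
      contract = G*B.trans (G*B.++-cong (G*B.refl {G*B.ι₂ a})
        (G*B.++-cong G*B.unit₁ (G*B.refl {G*B.ι₂ b}))) (G*B.mult₂ a b)
      ∥g∥≤1 : MG.∥ g ∥ ℝ.≤ ℝ.1#
      ∥g∥≤1 = begin
        MG.∥ g ∥                                          ≈⟨ MG.d-sandwich (ψ a) (ψ b) ⟨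
        G.d (ψ a G.∙ g G.∙ ψ b) (ψ a G.∙ G.ε G.∙ ψ b)
          ≈⟨ G.d-cong (G.sym eq) (G.trans (G.∙-congʳ (G.identityʳ _)) (G.sym (ψ-∙ a b))) ⟩
        G.d G.ε (ψ (a B.∙ b))                             ≈⟨ G.symmetric _ _ ⟩
        MG.∥ ψ (a B.∙ b) ∥                                ≈⟨ ∥ψ∥ _ ⟩
        MB.∥ a B.∙ b ∥                                    ≤⟨ bounded _ ⟩
        ℝ.1#                                              ∎
        where open ≤-Reasoning

    -- Together with `close` this transfers a stretch of trivial value from one height to the other,
    -- as `cancel` requires.
    open-up : ∀ i {h c} → Within h [] c → Segment i i h G.ε c
    open-up lo w = outer B.ε G.ε B.ε B.refl B.refl (ε-sandwich ψ-ε ψ-ε G.ε)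
      (within-resp G*B.refl (G*B.sym (tagged-trivial B.refl G.refl B.refl)) w)
      (ℝ.≤.reflexive (ℝ.trans (ℝ.+-congˡ (ℝ.+-identityˡ _)) (ℝ.+-identityʳ _)))
    open-up hi w = inner B.ε (G.sym ψ-ε) (within-resp G*B.refl (G*B.sym G*B.unit₂) w)

    -- Only the middle letter changes: `b` becomes the unit, or `g` becomes the element that makes
    -- the value trivial. By invariance either move has length `∥ y ∥`, and the tags stay.
    erase : ∀ {i j h y c} → Segment i j h y c → Segment i j h G.ε (c ℝ.+ MG.∥ y ∥)
    erase {y = y} (inner b eq w) = inner B.ε (G.sym ψ-ε)
      (within-trans w (within-letter (inj₂ b) (inj₂ B.ε)
        (ℝ.≤.reflexive (ℝ.trans (ℝ.sym (∥ψ∥ b)) (G.d-cong (G.sym eq) G.refl)))))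
    erase {y = y} (outer a g b p q eq w le) =
      outer a g′ b p q (G.sym trivial)
        (within-trans w (within-++ˡ (G*B.ι₂ a) (within-++ʳ (G*B.ι₂ b)
          (within-letter (inj₁ g) (inj₁ g′) (ℝ.≤.reflexive
            (ℝ.trans (ℝ.sym (MG.d-sandwich (ψ a) (ψ b))) (G.d-cong (G.sym eq) trivial)))))))
        (slide le)
      where
      g′ : G.Carrier
      g′ = ψ a G.⁻¹ G.∙ ψ b G.⁻¹
      trivial : ψ a G.∙ g′ G.∙ ψ b G.≈ G.ε
      trivial = G.trans (G.∙-congʳ (G.sym (G.assoc _ _ _)))
        (G.trans (G.∙-congʳ (G.trans (G.∙-congʳ (G.inverseʳ _)) (G.identityˡ _))) (G.inverseˡ _))

    -- Exactly one side of a crossing is at height `hi`, so the price 1 of the deleted letter is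
    -- stored as the weight of that end.
    deleted : ∀ j → Segment j (flip j) [] G.ε ℝ.1#
    deleted j = outer B.ε G.ε B.ε (tag-ε j) (tag-ε (flip j)) (ε-sandwich ψ-ε ψ-ε G.ε)
      (within-≋ (G*B.sym (tagged-trivial B.refl G.refl B.refl))) (le j)
      where
      le : ∀ j → ℝ.0# ℝ.+ (weight j ℝ.+ weight (flip j)) ℝ.≤ ℝ.1#
      le lo = ℝ.≤.trans 0+x≤x 0+x≤x
      le hi = ℝ.≤.trans 0+x≤x x+0≤x

    -- Alignments and their rewriting.

    -- cross lo is t, cross hi is t⁻¹
    data Atom : Set u where
      val   : G.Carrier → Atom
      cross : Height → Atom

    -- Cuts the original word along the surviving letters. A stretch of value `y` belongs to each
    -- surviving letter `y` of `G`; the stretches of trivial value before a crossing or at the end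
    -- hold what has been deleted there.
    data Align : Height → Height → G*B.Word → List Atom → ℝ.Carrier → Set u where
      end   : ∀ {i j h c} → Segment i j h G.ε c → Align i j h [] c
      val   : ∀ {i j k f h h′ y es a b c} → Segment i j h y a → Align j k h′ es b →
              h ++ h′ G*B.≋ f → a ℝ.+ b ℝ.≤ c → Align i k f (val y ∷ es) c
      cross : ∀ {i j k f h h′ es a b c} → Segment i j h G.ε a → Align (flip j) k h′ es b →
              h ++ h′ G*B.≋ f → a ℝ.+ b ℝ.≤ c → Align i k f (cross j ∷ es) c

    align-resp : ∀ {i j h h′ es b c} → h G*B.≋ h′ → b ℝ.≤ c → Align i j h es b → Align i j h′ es c
    align-resp p le (end S)           = end (segment-weaken le (segment-respʷ p S))
    align-resp p le (val S A eq l)    = val S A (G*B.trans eq p) (ℝ.≤.trans l le)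
    align-resp p le (cross S A eq l)  = cross S A (G*B.trans eq p) (ℝ.≤.trans l le)

    prepend : ∀ {i j k h h′ es a b} → Segment i j h G.ε a → Align j k h′ es b →
              Align i k (h ++ h′) es (a ℝ.+ b)
    prepend S (end T) = end (segment-respᵍ (G.identityˡ _) (join S T))
    prepend {h = h} S (val {h = h₁} T A eq le) =
      val (segment-respᵍ (G.identityˡ _) (join S T)) A
        (G*B.trans (Group.assoc G*B.group h h₁ _) (G*B.++-cong G*B.refl eq))
        (ℝ.≤.≲-respˡ-≈ (ℝ.sym (ℝ.+-assoc _ _ _)) (ℝ.+-monoʳ-≤ _ le))
    prepend {h = h} S (cross {h = h₁} T A eq le) =
      cross (segment-respᵍ (G.identityˡ _) (join S T)) A
        (G*B.trans (Group.assoc G*B.group h h₁ _) (G*B.++-cong G*B.refl eq))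
        (ℝ.≤.≲-respˡ-≈ (ℝ.sym (ℝ.+-assoc _ _ _)) (ℝ.+-monoʳ-≤ _ le))

    -- Uniform in the ends and the word, so that a rewriting can be applied behind any prefix, where
    -- the left end has changed.
    record _⇝[_]_ (es : List Atom) (s : ℝ.Carrier) (es′ : List Atom) : Set u where
      constructor ⇝-intro
      field apply : ∀ {i k h c} → Align i k h es c → Align i k h es′ (c ℝ.+ s)
    open _⇝[_]_

    ⇝-weaken : ∀ {es es′ s s′} → s ℝ.≤ s′ → es ⇝[ s ] es′ → es ⇝[ s′ ] es′
    ⇝-weaken le p .apply A = align-resp G*B.refl (ℝ.+-monoʳ-≤ _ le) (p .apply A)

    ⇝-refl : ∀ {es} → es ⇝[ ℝ.0# ] es
    ⇝-refl .apply A = align-resp G*B.refl (ℝ.≤.reflexive (ℝ.sym (ℝ.+-identityʳ _))) A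

    ⇝-trans : ∀ {es₁ es₂ es₃ s s′} → es₁ ⇝[ s ] es₂ → es₂ ⇝[ s′ ] es₃ → es₁ ⇝[ s ℝ.+ s′ ] es₃
    ⇝-trans p q .apply A =
      align-resp G*B.refl (ℝ.≤.reflexive (ℝ.+-assoc _ _ _)) (q .apply (p .apply A))

    ⇝-++ˡ : ∀ ps {es es′ s} → es ⇝[ s ] es′ → (ps ++ es) ⇝[ s ] (ps ++ es′)
    ⇝-++ˡ []       p = p
    ⇝-++ˡ (x ∷ ps) p .apply (val S A eq le) = val S (⇝-++ˡ ps p .apply A) eq
      (ℝ.≤.≲-respˡ-≈ (ℝ.+-assoc _ _ _) (ℝ.+-monoˡ-≤ _ le))
    ⇝-++ˡ (x ∷ ps) p .apply (cross S A eq le) = cross S (⇝-++ˡ ps p .apply A) eq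
      (ℝ.≤.≲-respˡ-≈ (ℝ.+-assoc _ _ _) (ℝ.+-monoˡ-≤ _ le))

    delete-val : ∀ {y es} → (val y ∷ es) ⇝[ MG.∥ y ∥ ] es
    delete-val .apply (val S A eq le) = align-resp eq (slide le) (prepend (erase S) A)

    delete-cross : ∀ {j es} → (cross j ∷ es) ⇝[ ℝ.1# ] es
    delete-cross {j} .apply (cross {h = h} S A eq le) =
      align-resp eq (slide le)
        (prepend (segment-respʷ (Group.identityʳ G*B.group h)
          (segment-respᵍ (G.identityˡ _) (join S (deleted j)))) A)

    -- The stretch between the two crossings has trivial value and both ends at height `flip j`. It
    -- is closed there, reopened at height `j` and absorbed by its neighbours without charge.
    cancel : ∀ {j es} → (cross j ∷ cross (flip j) ∷ es) ⇝[ ℝ.0# ] es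
    cancel {lo} .apply (cross S (cross T A eq′ le′) eq le) =
      align-resp (G*B.trans (G*B.++-cong G*B.refl eq′) eq)
        (ℝ.≤.trans (ℝ.+-monoʳ-≤ _ le′) (ℝ.≤.≲-respʳ-≈ (ℝ.sym (ℝ.+-identityʳ _)) le))
        (prepend S (prepend (open-up lo (close hi T)) A))
    cancel {hi} .apply (cross S (cross T A eq′ le′) eq le) =
      align-resp (G*B.trans (G*B.++-cong G*B.refl eq′) eq)
        (ℝ.≤.trans (ℝ.+-monoʳ-≤ _ le′) (ℝ.≤.≲-respʳ-≈ (ℝ.sym (ℝ.+-identityʳ _)) le))
        (prepend S (prepend (open-up hi (close lo T)) A))

    merge-val : ∀ {x y z es} → z G.≈ x G.∙ y → (val x ∷ val y ∷ es) ⇝[ ℝ.0# ] (val z ∷ es)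
    merge-val p .apply (val {h = h} S (val {h = h′} T A eq′ le′) eq le) =
      val (segment-respᵍ (G.sym p) (join S T)) A
        (G*B.trans (Group.assoc G*B.group h h′ _) (G*B.trans (G*B.++-cong G*B.refl eq′) eq))
        (ℝ.≤.trans (ℝ.≤.reflexive (ℝ.+-assoc _ _ _))
          (ℝ.≤.trans (ℝ.+-monoʳ-≤ _ le′) (ℝ.≤.≲-respʳ-≈ (ℝ.sym (ℝ.+-identityʳ _)) le)))

    -- Powers of `t` as sequences of crossings.

    crosses : Height → ℕ → List Atom
    crosses j n = replicate n (cross j)

    -- Spelling a power out in single letters loses nothing: its norm is the number of these
    -- letters, and products of powers arise by cancelling neighbours.
    powers : ℤ → List Atom
    powers (+ n)    = crosses lo n
    powers -[1+ n ] = crosses hi (suc n)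

    delete-crosses : ∀ j n {es} → (crosses j n ++ es) ⇝[ ℝ.fromℕ n ] es
    delete-crosses j zero    = ⇝-refl
    delete-crosses j (suc n) = ⇝-trans delete-cross (delete-crosses j n)

    delete-powers : ∀ m {es} → (powers m ++ es) ⇝[ ℝ.fromℕ ∣ m ∣ ] es
    delete-powers (+ n)    = delete-crosses lo n
    delete-powers -[1+ n ] = delete-crosses hi (suc n)

    -- The exponent of `t` in `m` copies of `cross j` followed by `n` copies of `cross (flip j)`.
    net : Height → ℕ → ℕ → ℤ
    net lo m n = m ℤ.⊖ n
    net hi m n = n ℤ.⊖ m

    net-suc : ∀ j m n → net j (suc m) (suc n) ≡ net j m n
    net-suc lo m n = ℤ.[1+m]⊖[1+n]≡m⊖n m n
    net-suc hi m n = ℤ.[1+m]⊖[1+n]≡m⊖n n m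

    net-zeroˡ : ∀ j n → crosses (flip j) n ≡ powers (net j 0 n)
    net-zeroˡ lo zero    = ≡.refl
    net-zeroˡ lo (suc n) = ≡.refl
    net-zeroˡ hi n       = ≡.refl

    net-zeroʳ : ∀ j n → crosses j n ≡ powers (net j n 0)
    net-zeroʳ lo n       = ≡.refl
    net-zeroʳ hi zero    = ≡.refl
    net-zeroʳ hi (suc n) = ≡.refl

    crosses-suc : ∀ j n es → cross j ∷ crosses j n ++ es ≡ crosses j n ++ cross j ∷ es
    crosses-suc j zero    es = ≡.refl
    crosses-suc j (suc n) es = ≡.cong (cross j ∷_) (crosses-suc j n es)

    ⇝-reflexive : ∀ {es es′} → es ≡ es′ → es ⇝[ ℝ.0# ] es′
    ⇝-reflexive ≡.refl = ⇝-refl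

    ⇝-trans₀ : ∀ {es₁ es₂ es₃} → es₁ ⇝[ ℝ.0# ] es₂ → es₂ ⇝[ ℝ.0# ] es₃ → es₁ ⇝[ ℝ.0# ] es₃
    ⇝-trans₀ p q = ⇝-weaken 0+x≤x (⇝-trans p q)

    merge-crosses : ∀ j m n {es} →
      (crosses j m ++ crosses (flip j) n ++ es) ⇝[ ℝ.0# ] (powers (net j m n) ++ es)
    merge-crosses j zero n {es} = ⇝-reflexive (≡.cong (_++ es) (net-zeroˡ j n))
    merge-crosses j (suc m) zero {es} = ⇝-reflexive (≡.cong (_++ es) (net-zeroʳ j (suc m)))
    merge-crosses j (suc m) (suc n) {es} =
      -- Moving the first crossing to the end of its block exposes the innermost opposite pair.
      ⇝-trans₀ (⇝-reflexive (crosses-suc j m _))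
        (⇝-trans₀ (⇝-++ˡ (crosses j m) cancel)
          (⇝-trans₀ (merge-crosses j m n)
            (⇝-reflexive (≡.cong (λ z → powers z ++ es) (≡.sym (net-suc j m n))))))

    crosses-+ : ∀ j m n es → crosses j m ++ crosses j n ++ es ≡ crosses j (m ℕ.+ n) ++ es
    crosses-+ j zero    n es = ≡.refl
    crosses-+ j (suc m) n es = ≡.cong (cross j ∷_) (crosses-+ j m n es)

    merge-powers : ∀ m n {es} →
      (powers m ++ powers n ++ es) ⇝[ ℝ.0# ] (powers (m ℤ.+ n) ++ es)
    merge-powers (+ m)    (+ n)    = ⇝-reflexive (crosses-+ lo m n _)
    merge-powers (+ m)    -[1+ n ] = merge-crosses lo m (suc n)
    merge-powers -[1+ m ] (+ n)    = merge-crosses hi (suc m) n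
    -- The sum is `-[1+ suc (m + n) ]`, so the leading crossing of the second block is pulled out to
    -- the front.
    merge-powers -[1+ m ] -[1+ n ] {es} = ⇝-reflexive
      (≡.cong (cross hi ∷_) (≡.trans (≡.sym (crosses-suc hi m _))
        (≡.cong (cross hi ∷_) (crosses-+ hi m n es))))

    atomsOf : K.Letter → List Atom
    atomsOf (inj₁ g)      = val g ∷ []
    atomsOf (inj₂ (t^ m)) = powers m

    atoms : K.Word → List Atom
    atoms []      = []
    atoms (x ∷ w) = atomsOf x ++ atoms w

    step-atoms : ∀ {v w c} → C.Step v w c → atoms v ⇝[ c ] atoms w
    step-atoms (C.merge (C.mul₁ p)) = merge-val p
    step-atoms (C.merge (C.mul₂ {t^ m} {t^ n} ≡.refl)) = merge-powers m n
    step-atoms (C.delete {inj₁ y}) = delete-val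
    step-atoms (C.delete {inj₂ (t^ m)}) =
      ⇝-weaken (ℝ.≤.reflexive (ℝ.reflexive
        (≡.cong (λ z → ℝ.fromℕ ∣ z ∣) (≡.sym (ℤ.+-identityʳ m))))) (delete-powers m)
    step-atoms (C.skip {x} s) = ⇝-++ˡ (atomsOf x) (step-atoms s)

    -- The strategy is followed while `c` records what has been spent. When no letter survives, a
    -- single stretch of trivial value from `lo` to `lo` is left, and `close` destroys `h`.
    collapse-align : ∀ {v b c h} → C.Collapses v b → Align lo lo h (atoms v) c →
                     Within h [] (c ℝ.+ b)
    collapse-align (C.done p) (end S) = within-weaken (x≤x+y p) (close lo S)
    collapse-align (C.step s q le) A = within-weaken
      (ℝ.≤.≲-respˡ-≈ (ℝ.sym (ℝ.+-assoc _ _ _)) (ℝ.+-monoʳ-≤ _ le))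
      (collapse-align q (step-atoms s .apply A))

    -- Before any deletion every stretch represents its part of `h` exactly, so no price has
    -- accrued.
    align-expand : ∀ h → Align lo lo h (atoms (expand h)) ℝ.0#
    align-expand [] = end (open-up lo (within-[] ℝ.≤.refl))
    align-expand (inj₁ g ∷ h) =
      val (outer B.ε g B.ε B.refl B.refl (ε-sandwich ψ-ε ψ-ε g)
            (within-≋ (G*B.sym (G*B.++-cong (G*B.unit₂)
              (G*B.++-cong (G*B.refl {G*B.ι₁ g}) G*B.unit₂))))
            (ℝ.≤.trans 0+x≤x 0+x≤x))
        (align-expand h) G*B.refl 0+x≤x
    align-expand (inj₂ b ∷ h) =
      cross (open-up lo (within-[] ℝ.≤.refl))
        (val (inner b G.refl (within-refl (G*B.ι₂ b)))
          (cross (open-up hi (within-[] ℝ.≤.refl)) (align-expand h) G*B.refl 0+x≤x)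
          G*B.refl 0+x≤x)
        G*B.refl 0+x≤x

    collapses⇒within : ∀ {h c} → C.Collapses (expand h) c → Within h [] c
    collapses⇒within {h} p = within-weaken 0+x≤x (collapse-align p (align-expand h))

-- The discrete metric on a group.

module _ {u} (em : ExcludedMiddle u) (ℝ : CompleteOrderedField u) where
  open CompleteOrderedField ℝ
  open Real ℝ

  private
    indicator : ∀ {P : Set u} → Dec P → Carrier
    indicator (yes _) = 0#
    indicator (no _)  = 1#

    indicator-true : ∀ {P} → P → (p? : Dec P) → indicator p? ≈ 0#
    indicator-true p (yes _) = refl
    indicator-true p (no ¬p) = contradiction p ¬p

    indicator-≈0 : ∀ {P} (p? : Dec P) → indicator p? ≈ 0# → P
    indicator-≈0 (yes p) _  = p
    indicator-≈0 (no _)  eq = contradiction (sym eq) 0≉1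

    indicator-⇔ : ∀ {P Q} → (P → Q) → (Q → P) → (p? : Dec P) (q? : Dec Q) →
                  indicator p? ≈ indicator q?
    indicator-⇔ f g (yes p) q?      = sym (indicator-true (f p) q?)
    indicator-⇔ f g (no ¬p) (yes q) = contradiction (g q) ¬p
    indicator-⇔ f g (no ¬p) (no ¬q) = refl

    indicator-nonNeg : ∀ {P} (p? : Dec P) → 0# ≤ indicator p?
    indicator-nonNeg (yes _) = ≤.refl
    indicator-nonNeg (no _)  = 0≤1

    indicator-≤1 : ∀ {P} (p? : Dec P) → indicator p? ≤ 1#
    indicator-≤1 (yes _) = 0≤1
    indicator-≤1 (no _)  = ≤.refl

    indicator-× : ∀ {P Q R} → (P → Q → R) → (r? : Dec R) (p? : Dec P) (q? : Dec Q) →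
                  indicator r? ≤ indicator p? + indicator q?
    indicator-× f (yes r) p?      q?      = +-nonNeg (indicator-nonNeg p?) (indicator-nonNeg q?)
    indicator-× f (no ¬r) (no _)  q?      = x≤x+y (indicator-nonNeg q?)
    indicator-× f (no ¬r) (yes _) (no _)  = x≤y+x ≤.refl
    indicator-× f (no ¬r) (yes p) (yes q) = contradiction (f p q) ¬r

  -- Equality is decided by excluded middle. All norms are at most 1, so for this metric the
  -- imitation of strategies is available for any subgroup `A`.
  discrete : Group u u → MetricGroup ℝ
  discrete Γ = record
    { group      = Γ
    ; d          = λ x y → indicator (x ≟ y)
    ; d-cong     = λ p q → indicator-⇔ (λ r → Γ.trans (Γ.sym p) (Γ.trans r q))
                     (λ r → Γ.trans p (Γ.trans r (Γ.sym q))) (_ ≟ _) (_ ≟ _)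
    ; nonNeg     = λ x y → indicator-nonNeg (x ≟ y)
    ; d≈0⇒≈      = indicator-≈0 (_ ≟ _)
    ; ≈⇒d≈0      = λ p → indicator-true p (_ ≟ _)
    ; symmetric  = λ x y → indicator-⇔ Γ.sym Γ.sym (x ≟ y) (y ≟ x)
    ; triangle   = λ x y z → indicator-× Γ.trans (x ≟ z) (x ≟ y) (y ≟ z)
    ; invariantˡ = λ z x y → indicator-⇔ (∙-cancelˡ z x y) Γ.∙-congˡ (_ ≟ _) (_ ≟ _)
    ; invariantʳ = λ z x y → indicator-⇔ (∙-cancelʳ z x y) Γ.∙-congʳ (_ ≟ _) (_ ≟ _)
    }
    where
    module Γ = Group Γ
    open GroupProperties Γ using (∙-cancelˡ; ∙-cancelʳ)
    _≟_ : ∀ x y → Dec (x Γ.≈ y)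
    x ≟ y = em

  discrete-≤1 : ∀ Γ x y → MetricGroup.d (discrete Γ) x y ≤ 1#
  discrete-≤1 Γ x y = indicator-≤1 em

-- The canonical map and the two metrics on `G * tAt⁻¹`.

module Canonical {u} {ℝ : CompleteOrderedField u} (G : MetricGroup ℝ)
                 (A : Subgroup (MetricGroup.group G)) where
  private
    module ℝ = CompleteOrderedField ℝ
    module G = MetricGroup G
    module MG = Metric G
  open Conjugation G A
  private
    B = tAt⁻¹-metricGroup
    module B = MetricGroup B
    module G*B = FreeProduct G.group B.group
    module K = FreeProduct G.group (⟨t⟩-group u)
    module GB = Graev G B
    module D = Distance G B
    module KD = Distance G (⟨t⟩-metricGroup ℝ)
    module C = Collapse G (⟨t⟩-metricGroup ℝ)
    -- The operation and the metric of `tAt⁻¹` are computed on conjugands, so the conditions on `ψ`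
    -- hold by reflexivity.
    module E = Expansion G B conjugand (λ _ _ → G.refl) G.refl (λ _ _ → ℝ.refl)
    L = Subgroup.group ⟨G∪tAt⁻¹⟩
    module L = Group L
  open Real ℝ

  image : G*B.Word → K.Word
  image w = proj₁ (canonical w)

  image-cong : ∀ {v w} → v G*B.≋ w → image v K.≋ image w
  image-cong = G*B.lift-cong L _ _
    (record
      { isMonoidHomomorphism = record
        { isMagmaHomomorphism = record
          { isRelHomomorphism = record { cong = K.cong₁ }
          ; homo              = λ x y → K.sym (K.mult₁ x y)
          }
        ; ε-homo = K.unit₁
        }
      ; ⁻¹-homo = λ _ → K.refl
      })
    (record
      { isMonoidHomomorphism = record
        { isMagmaHomomorphism = record
          { isRelHomomorphism = record { cong = id }
          ; homo              = λ _ _ → K.refl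
          }
        ; ε-homo = K.refl
        }
      ; ⁻¹-homo = λ _ → K.refl
      })

  image-++ : ∀ v w → image (v ++ w) K.≋ image v ++ image w
  image-++ []      w = K.refl
  image-++ (x ∷ v) w = K.trans (K.++-cong K.refl (image-++ v w))
    (K.sym (Group.assoc K.group (proj₁ (lift-letter x)) (image v) (image w)))
    where
    lift-letter : G*B.Letter → L.Carrier
    lift-letter = G*B.lift-letter L (λ g → embed g , gen∈ (inj₁ (g , K.refl)))
                    (λ (x , p) → x , gen∈ (inj₂ p))

  image-inv : ∀ w → image (G*B.inv w) K.≋ K.inv (image w)
  image-inv w = GroupProperties.inverseˡ-unique K.group (image (G*B.inv w)) (image w)
    (K.trans (K.sym (image-++ (G*B.inv w) w)) (image-cong (Group.inverseˡ G*B.group w)))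

  image-surjective : ∀ {x} → Subgroup.Member ⟨G∪tAt⁻¹⟩ x → ∃[ w ] image w K.≋ x
  image-surjective (gen∈ (inj₁ (g , p))) = G*B.ι₁ g , K.sym p
  image-surjective {x} (gen∈ (inj₂ p))   = G*B.ι₂ (x , p) , Group.identityʳ K.group x
  image-surjective (gen≈ p q)            = map₂ (λ r → K.trans r p) (image-surjective q)
  image-surjective genε                  = [] , K.refl
  image-surjective (gen∙ p q)            =
    let v , v≋ = image-surjective p
        w , w≋ = image-surjective q
    in v ++ w , K.trans (image-++ v w) (K.++-cong v≋ w≋)
  image-surjective (gen⁻¹ p)             =
    let w , w≋ = image-surjective p
    in G*B.inv w , K.trans (image-inv w) (Group.⁻¹-cong K.group w≋)

  image-expand : ∀ w → image w K.≋ E.expand w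
  image-expand []           = K.refl
  image-expand (inj₁ g ∷ w) = K.++-cong (K.refl {K.ι₁ g}) (image-expand w)
  image-expand (inj₂ (x , b , (a , _ , b≋a) , x≋) ∷ w) = K.++-cong
    (K.trans x≋ (K.++-cong (K.++-cong (K.refl {t}) b≋a) (K.refl {K.inv t})))
    (image-expand w)

  d|≤d̲ : ∀ f g → d| f g ℝ.≤ d̲ f g
  d|≤d̲ f g = D.≤-graev λ (_ , α , β , p , q , eq) →
    KD.graev-≤ (KD.within-weaken (ℝ.≤.reflexive (ℝ.sym eq))
      (KD.within-resp (image-product α p) (image-product β q) (E.within-expand α β)))
    where
    image-product : ∀ {n f} (α : Vec G*B.Letter n) → GB.product α G*B.≋ f →
                    E.expand (GB.product α) K.≋ image f
    image-product α p = K.trans (K.sym (image-expand (GB.product α))) (image-cong p)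

  module _ (bounded : ∀ b → Metric.∥_∥ B b ℝ.≤ ℝ.1#) where

    -- The destroyed word is the expansion of `f g⁻¹`; the imitation brings `f g⁻¹` to the empty
    -- word, and `g` is multiplied back on the right. Both `d̲≤d|` and injectivity follow from this.
    collapses-image⇒within : ∀ {f g c} → C.Collapses (image f ++ K.inv (image g)) c →
                             D.Within f g c
    collapses-image⇒within {f} {g} {c} p = D.within-resp
      (G*B.trans (Group.assoc G*B.group f (G*B.inv g) g)
        (G*B.trans (G*B.++-cong G*B.refl (Group.inverseˡ G*B.group g))
          (Group.identityʳ G*B.group f)))
      G*B.refl
      (D.within-++ʳ g (E.collapses⇒within bounded {f ++ G*B.inv g}
        (C.collapses-resp image-// p)))
      where
      image-// : image f ++ K.inv (image g) K.≋ E.expand (f ++ G*B.inv g)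
      image-// = K.trans (K.++-cong K.refl (K.sym (image-inv g)))
        (K.trans (K.sym (image-++ f (G*B.inv g))) (image-expand (f ++ G*B.inv g)))

    d̲≤d| : ∀ f g → d̲ f g ℝ.≤ d| f g
    d̲≤d| f g = KD.≤-graev λ p →
      D.graev-≤ (collapses-image⇒within {f} {g} (C.costs⇒collapses p))

    -- Equal images have a quotient equal to the empty word, which is destroyed for price 0; the
    -- imitation then costs 0 as well.
    image-injective : ∀ {f g} → image f K.≋ image g → f G*B.≋ g
    image-injective {f} {g} p = D.within-0⇒≋ (collapses-image⇒within {f} {g}
      (C.collapses-resp
        (K.trans (K.sym (Group.inverseʳ K.group (image g))) (K.++-cong (K.sym p) K.refl))
        (C.done ℝ.≤.refl)))

  isometric⇒diam≤1 : (∀ f g → d| f g ℝ.≈ d̲ f g) → diam≤ G A ℝ.1#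
  -- The bound 1 comes first; completeness then supplies the supremum that makes the diameter
  -- finite.
  isometric⇒diam≤1 iso = map₂ (λ sup → sup , proj₂ sup upper)
    (ℝ.complete (distances G A) (_ , G.ε , G.ε , ε-closed , ε-closed , ℝ.refl) (ℝ.1# , upper))
    where
    open Subgroup A
    -- The words `ε a ε` and `t a t⁻¹` are compared letter by letter, at cost 1 + 0 + 1.
    near : ∀ a → KD.Within (K.ι₁ a) (t ++ K.ι₁ a ++ K.inv t) (ℝ.1# ℝ.+ ℝ.1#)
    near a = KD.within-resp
      (K.++-cong K.unit₁ (K.++-cong (K.refl {K.ι₁ a}) K.unit₁)) K.refl
      (KD.within-++ {K.ι₁ G.ε} {K.ι₁ a ++ K.ι₁ G.ε}
        (KD.within-letter (inj₁ G.ε) (inj₂ (t^ ℤ.1ℤ)) unit-cost)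
        (KD.within-++ˡ (K.ι₁ a)
          (KD.within-letter (inj₁ G.ε) (inj₂ (t^ (ℤ.- ℤ.1ℤ))) unit-cost)))
      where
      unit-cost : G.d G.ε G.ε ℝ.+ (ℝ.1# ℝ.+ ℝ.0#) ℝ.≤ ℝ.1#
      unit-cost = ℝ.≤.reflexive (ℝ.trans (ℝ.+-congʳ MG.d-refl)
        (ℝ.trans (ℝ.+-identityˡ _) (ℝ.+-identityʳ _)))
    ∥a∥≤1 : ∀ a → Member a → MG.∥ a ∥ ℝ.≤ ℝ.1#
    ∥a∥≤1 a a∈A = x+x≤y+y⇒x≤y (begin
      MG.∥ a ∥ ℝ.+ MG.∥ a ∥
        -- The first word projects to `a` and `ε`, the second to `ε` and `tat⁻¹`, whose conjugand is
        -- `a`: each factor contributes `∥ a ∥`. The extra units come from evaluating one-letter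
        -- words.
        ≈⟨ ℝ.+-cong (G.d-cong (G.sym (G.identityʳ a)) (G.sym (G.identityˡ G.ε)))
             (ℝ.trans (G.symmetric a G.ε)
               (G.d-cong (G.sym (G.identityˡ G.ε)) (G.sym (G.identityʳ a)))) ⟩
      G.d (a G.∙ G.ε) (G.ε G.∙ G.ε) ℝ.+ G.d (G.ε G.∙ G.ε) (a G.∙ G.ε)
        ≤⟨ D.project-≤-graev (G*B.ι₁ a) (G*B.ι₂ tat⁻¹) ⟩
      d̲ (G*B.ι₁ a) (G*B.ι₂ tat⁻¹)
        ≈⟨ iso (G*B.ι₁ a) (G*B.ι₂ tat⁻¹) ⟨
      d| (G*B.ι₁ a) (G*B.ι₂ tat⁻¹)
        ≤⟨ KD.graev-≤ (near a) ⟩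
      ℝ.1# ℝ.+ ℝ.1#   ∎)
      where
      open ≤-Reasoning
      tat⁻¹ : B.Carrier
      tat⁻¹ = (t ++ K.ι₁ a) ++ K.inv t , K.ι₁ a , (a , a∈A , K.refl) , K.refl
    upper : ℝ.IsUpperBound (distances G A) ℝ.1#
    upper (a , b , a∈A , b∈A , eq) =
      -- By invariance a distance in `A` is the norm of the quotient, which lies in `A` again.
      ℝ.≤.≲-respˡ-≈ (ℝ.trans (MG.∥x∙y⁻¹∥ a b) (ℝ.sym eq))
        (∥a∥≤1 (a G.∙ b G.⁻¹) (∙-closed a∈A (⁻¹-closed b∈A)))

  diam≤1⇒isometric : diam≤ G A ℝ.1# → ∀ f g → d| f g ℝ.≈ d̲ f g
  diam≤1⇒isometric (_ , (upper , _) , D≤1) f g =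
    ℝ.≤.antisym (d|≤d̲ f g) (d̲≤d| bounded f g)
    where
    open Subgroup A
    bounded : ∀ b → Metric.∥_∥ B b ℝ.≤ ℝ.1#
    bounded (_ , _ , (a , a∈A , _) , _) =
      ℝ.≤.trans (upper (a , G.ε , a∈A , ε-closed , ℝ.refl)) D≤1

mainTheorem10 :
    ∀ {u} → ExcludedMiddle u →
    (ℝ : CompleteOrderedField u) (G : MetricGroup ℝ) (A : Subgroup (MetricGroup.group G)) →
    IsClosed G A →
    let open CompleteOrderedField ℝ
        open Conjugation G A
    in canonical-isIsomorphism ×
       ((∀ f₁ f₂ → d| f₁ f₂ ≈ d̲ f₁ f₂) ⇔ diam≤ G A 1#)
mainTheorem10 em ℝ G A _ = isomorphism , mk⇔ isometric⇒diam≤1 diam≤1⇒isometric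
  where
  open Conjugation G A
  open Canonical G A
  module K = Group G*⟨t⟩
  Γ = MetricGroup.group G
  -- Injectivity does not involve the metric on G, so it may be chosen discrete.
  injective : ∀ {f g} → image f K.≈ image g → Group._≈_ G*tAt⁻¹ f g
  injective {f} {g} = Canonical.image-injective (discrete em ℝ Γ) A
    (λ b → discrete-≤1 em ℝ Γ _ _) {f} {g}
  isomorphism : canonical-isIsomorphism
  isomorphism = record
    { isGroupMonomorphism = record
      { isGroupHomomorphism = record
        { isMonoidHomomorphism = record
          { isMagmaHomomorphism = record
            { isRelHomomorphism = record { cong = image-cong }
            ; homo              = image-++
            }
          ; ε-homo = K.refl
          }
        ; ⁻¹-homo = image-inv
        }
      ; injective = λ {f} {g} → injective {f} {g}
      }
    ; surjective = λ (_ , p) →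
        let w , w≋ = image-surjective p in w , λ z≋w → K.trans (image-cong z≋w) w≋
    }
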